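{- Let $p\ge7$ be prime. Then the structure $(\mathbb{F}_p[t],+,M)$ is NIP, where $M=\{(t^i,t^j,t^{i+j}):i,j\in\mathbb{N}\}\subseteq\mathbb{F}_p[t]^3$ is a ternary relation.
   Context: $\mathbb{N}$ includes $0$; $\mathbb{F}_p[t]$ is the polynomial ring in one variable over the field with $p$ elements, and $+$ is its addition. -}

module Defs where

open import Data.Nat using (ℕ; zero; suc; _+_; NonZero)
open import Data.Nat.DivMod using (_mod_)
open import Data.Fin using (Fin; toℕ)
open import Data.Fin.Subset using (Subset; _∈_)
open import Data.List using (List; []; _∷_)
open import Data.Product using (Σ; _×_)
open import Data.Empty using (⊥)
open import Relation.Nullary using (¬_)
open import Relation.Binary.PropositionalEquality using (_≡_)
open import Data.Vec.Functional as VF using (Vector)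

-- The polynomial ring 𝔽_p[t], additive structure.
-- A polynomial is represented by its list of coefficients
-- [a₀, a₁, …] (aₖ = coefficient of tᵏ) with aₖ ∈ Fin p = 𝔽_p.
-- Two lists denote the same polynomial iff all coefficients agree
-- (trailing zeros are irrelevant); this is the equality of the structure.

module _ (p : ℕ) .{{_ : NonZero p}} where

  Poly : Set
  Poly = List (Fin p)

  coeff : ℕ → Poly → ℕ
  coeff k       []       = 0
  coeff zero    (x ∷ a)  = toℕ x
  coeff (suc k) (x ∷ a)  = coeff k a

  _≈_ : Poly → Poly → Set
  a ≈ b = ∀ k → coeff k a ≡ coeff k b

  _⊕_ : Poly → Poly → Poly
  []      ⊕ b       = b
  (x ∷ a) ⊕ []      = x ∷ a
  (x ∷ a) ⊕ (y ∷ b) = ((toℕ x + toℕ y) mod p) ∷ (a ⊕ b)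

  δ : ℕ → ℕ → ℕ
  δ zero    zero    = 1
  δ zero    (suc j) = 0
  δ (suc i) zero    = 0
  δ (suc i) (suc j) = δ i j

  IsPow : ℕ → Poly → Set
  IsPow i a = ∀ k → coeff k a ≡ δ k i

  M : Poly → Poly → Poly → Set
  M a b c = Σ ℕ λ i → Σ ℕ λ j → IsPow i a × IsPow j b × IsPow (i + j) c

  data Term (n : ℕ) : Set where
    var  : Fin n → Term n
    _⊞_  : Term n → Term n → Term n

  data Formula : ℕ → Set where
    _≐_  : ∀ {n} → Term n → Term n → Formula n
    rel  : ∀ {n} → Term n → Term n → Term n → Formula n
    ~_   : ∀ {n} → Formula n → Formula n
    _∧_  : ∀ {n} → Formula n → Formula n → Formula n
    ∃'   : ∀ {n} → Formula (suc n) → Formula n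

  eval : ∀ {n} → Term n → Vector Poly n → Poly
  eval (var v) e = e v
  eval (s ⊞ t) e = eval s e ⊕ eval t e

  -- Satisfaction (classical: ∃ is interpreted as ¬¬Σ, so every
  -- formula has a ¬¬-stable truth value).
  Sat : ∀ {n} → Formula n → Vector Poly n → Set
  Sat (s ≐ t)     e = eval s e ≈ eval t e
  Sat (rel s t u) e = M (eval s e) (eval t e) (eval u e)
  Sat (~ φ)       e = ¬ Sat φ e
  Sat (φ ∧ ψ)     e = Sat φ e × Sat ψ e
  Sat (∃' φ)      e = ¬ ¬ (Σ Poly λ a → Sat φ (a VF.∷ e))

  HasIP : ∀ m k → Formula (m + k) → Set
  HasIP m k φ = ∀ (N : ℕ) →
    Σ (Fin N → Vector Poly m) λ a →
    Σ (Subset N → Vector Poly k) λ b →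
      ∀ (i : Fin N) (S : Subset N) →
        (Sat φ (a i VF.++ b S) → i ∈ S) × (i ∈ S → Sat φ (a i VF.++ b S))

  NIP : Set
  NIP = ∀ m k (φ : Formula (m + k)) → ¬ HasIP m k φ

{-# OPTIONS --safe #-}
module Submission where

-- Elements are finitely supported functions ℕ → ℤ/p, and M makes their exponents a copy of (ℕ, +).
--
-- Two tuples v, v′ are s-equivalent when a partial matching of exponents preserves the
-- signs and residues of bounded linear forms, and every linear combination of v either corresponds
-- to that of v′ along the matching or both are not sums of s monomials.  This is a back-and-forth
-- system: an element that is short modulo the span of v is transported monomial by monomial, and
-- any other one is answered by a polynomial with too many coefficients equal to 1.  Hence
-- 2 ^ r-equivalent tuples satisfy the same formulas of quantifier rank r.
--
-- Over parameters a₀, …, a_{N-1} there are only polynomially many classes of tuples b.  If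
-- λ a_i + μ b is short for some i, it differs from every λ a_{i′} + μ b by λ (a_i − a_{i′}), so the
-- class of b is fixed by one such i, the coefficients of the short combination, and the type of its
-- exponents over the polynomially many exponents of the short gaps λ (a_i − a_{i′}).  The latter type
-- is a bounded number of cuts and residues.  A shattered set would need 2 ^ N classes.

open import Defs
open import Data.Empty using (⊥)
open import Data.Fin as Fin using (Fin; toℕ; fromℕ<)
import Data.Fin.Properties as Fin
open import Data.Fin.Subset as Subset using (Subset; Side; inside; outside)
import Data.Fin.Subset.Properties as Subset
open import Data.Integer as ℤ using (ℤ; +_; -[1+_]; 0ℤ; 1ℤ; +≤+; _+_; _-_; _*_; -_; _≤_)
import Data.Integer.DivMod as ℤ
import Data.Integer.Properties as ℤ
open import Data.Integer.Tactic.RingSolver using (solve-∀)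
open import Data.List as List using (List; []; _∷_; length; cartesianProductWith)
open import Data.List.Membership.Propositional using (_∈_)
import Data.List.Membership.Propositional.Properties as ∈
import Data.List.Properties as List
open import Data.List.Relation.Unary.Any using (here; there; index)
import Data.List.Relation.Unary.Any.Properties as Any
open import Data.Nat as ℕ using (ℕ; zero; suc; NonZero; _!; z≤n; s≤s)
import Data.Nat.Coprimality as ℕ
import Data.Nat.Divisibility as ℕ
import Data.Nat.DivMod as ℕ
open import Data.Nat.GCD using (module Bézout)
open import Data.Nat.Primality using (Prime; prime⇒nonTrivial)
import Data.Nat.Properties as ℕ
import Data.Nat.Tactic.RingSolver as ℕ
open import Data.Product using (Σ; ∃₂; _×_; _,_; proj₁; proj₂)
open import Data.Sum using (_⊎_; inj₁; inj₂)
open import Data.Vec as Vec using (Vec; []; _∷_; lookup; _++_; map)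
import Data.Vec.Functional.Properties as Vector
open import Data.Vec.Functional as Vector using (Vector)
import Data.Vec.Properties as Vec
open import Function using (_∘_; _⇔_; mk⇔; Equivalence)
open import Function.Construct.Composition using (_⇔-∘_)
open import Function.Construct.Symmetry using (⇔-sym)
open import Level using (Level)
open import Relation.Binary.PropositionalEquality
open import Relation.Nullary using (¬_; Dec; yes; no; contradiction)

open Equivalence using (to; from)

private variable
  ℓ ℓ′ : Level

-- Classical reasoning under double negation.

infixl 1 _>>=_
_>>=_ : {A : Set ℓ} {B : Set ℓ′} → ¬ ¬ A → (A → ¬ ¬ B) → ¬ ¬ B
(m >>= f) k = m λ a → f a k

return : {A : Set ℓ} → A → ¬ ¬ A
return a k = k a

-- Excluded middle in this form suffices: non-IP is a negation, and `Sat` interprets the existential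
-- quantifier by a double negation.
lem : (A : Set ℓ) → ¬ ¬ Dec A
lem A k = k (no (k ∘ yes))

-- Congruences of integers.

infix 4 _≋[_]_
-- The quotient is kept as data because the integer `ŷ` is computed from it below.
record _≋[_]_ (a : ℤ) (n : ℕ) (b : ℤ) : Set where
  constructor by
  field
    quot  : ℤ
    proof : a ≡ b + quot * + n

module _ {n : ℕ} where

  ≋-reflexive : ∀ {a b} → a ≡ b → a ≋[ n ] b
  ≋-reflexive {a} refl = by 0ℤ (lemma a (+ n))
    where lemma : ∀ a n → a ≡ a + 0ℤ * n
          lemma = solve-∀

  ≋-refl : ∀ {a} → a ≋[ n ] a
  ≋-refl = ≋-reflexive refl

  ≋-sym : ∀ {a b} → a ≋[ n ] b → b ≋[ n ] a
  ≋-sym {_} {b} (by q refl) = by (- q) (lemma b q (+ n))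
    where lemma : ∀ b q n → b ≡ b + q * n + (- q) * n
          lemma = solve-∀

  ≋-trans : ∀ {a b c} → a ≋[ n ] b → b ≋[ n ] c → a ≋[ n ] c
  ≋-trans {c = c} (by q refl) (by r refl) = by (r + q) (lemma c q r (+ n))
    where lemma : ∀ c q r n → c + r * n + q * n ≡ c + (r + q) * n
          lemma = solve-∀

  +-cong : ∀ {a b c d} → a ≋[ n ] b → c ≋[ n ] d → a + c ≋[ n ] b + d
  +-cong {_} {b} {_} {d} (by q refl) (by r refl) = by (q + r) (lemma b d q r (+ n))
    where lemma : ∀ b d q r n → b + q * n + (d + r * n) ≡ b + d + (q + r) * n
          lemma = solve-∀

  *-cong : ∀ {a b c d} → a ≋[ n ] b → c ≋[ n ] d → a * c ≋[ n ] b * d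
  *-cong {_} {b} {_} {d} (by q refl) (by r refl) = by (q * d + b * r + q * r * + n) (lemma b d q r (+ n))
    where lemma : ∀ b d q r n → (b + q * n) * (d + r * n) ≡ b * d + (q * d + b * r + q * r * n) * n
          lemma = solve-∀

  *-congʳ : ∀ k {a b} → a ≋[ n ] b → k * a ≋[ n ] k * b
  *-congʳ k = *-cong (≋-refl {k})

  neg-cong : ∀ {a b} → a ≋[ n ] b → - a ≋[ n ] - b
  neg-cong {_} {b} (by q refl) = by (- q) (lemma b q (+ n))
    where lemma : ∀ b q n → - (b + q * n) ≡ - b + (- q) * n
          lemma = solve-∀

  %-≋ : .{{_ : NonZero n}} → ∀ m → + m ≋[ n ] + (m ℕ.% n)
  %-≋ m = by (+ (m ℕ./ n)) (trans (cong +_ (ℕ.m≡m%n+[m/n]*n m n))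
    (trans (ℤ.pos-+ (m ℕ.% n) _) (cong (λ z → + (m ℕ.% n) + z) (ℤ.pos-* (m ℕ./ n) n))))

≋-∣ : ∀ {a b} L D → a ≋[ L ℕ.* D ] b → a ≋[ D ] b
≋-∣ {b = b} L D (by q refl) =
  by (q * + L) (cong (λ z → b + z) (trans (cong (q *_) (ℤ.pos-* L D)) (sym (ℤ.*-assoc q (+ L) (+ D)))))

-- Back and forth for Presburger arithmetic

Rel : Set₁
Rel = ℕ → ℕ → Set

private variable
  R R′ : Rel
  c d : ℕ
  z z′ w w′ : ℤ

-- The weight c is only an upper bound, because of skip.
data Lin (R : Rel) : ℕ → ℤ → ℤ → Set where
  nil  : Lin R 0 0ℤ 0ℤ
  skip : Lin R c z z′ → Lin R (suc c) z z′
  pos  : ∀ {x x′} → R x x′ → Lin R c z z′ → Lin R (suc c) (+ x + z) (+ x′ + z′)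
  neg  : ∀ {x x′} → R x x′ → Lin R c z z′ → Lin R (suc c) (- + x + z) (- + x′ + z′)

Lin-cast : z ≡ w → z′ ≡ w′ → Lin R c z z′ → Lin R c w w′
Lin-cast refl refl l = l

Lin-skip : Lin R c z z′ → ∀ d → Lin R (d ℕ.+ c) z z′
Lin-skip l zero    = l
Lin-skip l (suc d) = skip (Lin-skip l d)

Lin-weaken : c ℕ.≤ d → Lin R c z z′ → Lin R d z z′
Lin-weaken {R = R} {z = z} {z′ = z′} c≤d l =
  subst (λ e → Lin R e z z′) (ℕ.m∸n+n≡m c≤d) (Lin-skip l _)

Lin-zero : ∀ c → Lin R c 0ℤ 0ℤ
Lin-zero zero    = nil
Lin-zero (suc c) = skip (Lin-zero c)

Lin-flip : Lin R c z z′ → Lin (λ x x′ → R x′ x) c z′ z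
Lin-flip nil       = nil
Lin-flip (skip l)  = skip (Lin-flip l)
Lin-flip (pos r l) = pos r (Lin-flip l)
Lin-flip (neg r l) = neg r (Lin-flip l)

Lin-+ : Lin R c z z′ → Lin R d w w′ → Lin R (c ℕ.+ d) (z + w) (z′ + w′)
Lin-+ nil       m = Lin-cast (sym (ℤ.+-identityˡ _)) (sym (ℤ.+-identityˡ _)) m
Lin-+ (skip l)  m = skip (Lin-+ l m)
Lin-+ {w = w} {w′ = w′} (pos {z = z} {z′} {x} {x′} r l) m =
  Lin-cast (sym (ℤ.+-assoc (+ x) z w)) (sym (ℤ.+-assoc (+ x′) z′ w′)) (pos r (Lin-+ l m))
Lin-+ {w = w} {w′ = w′} (neg {z = z} {z′} {x} {x′} r l) m =
  Lin-cast (sym (ℤ.+-assoc (- + x) z w)) (sym (ℤ.+-assoc (- + x′) z′ w′)) (neg r (Lin-+ l m))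

Lin-neg : Lin R c z z′ → Lin R c (- z) (- z′)
Lin-neg nil       = nil
Lin-neg (skip l)  = skip (Lin-neg l)
Lin-neg (pos {x = x} {x′} r l) =
  Lin-cast (sym (ℤ.neg-distrib-+ (+ x) _)) (sym (ℤ.neg-distrib-+ (+ x′) _)) (neg r (Lin-neg l))
Lin-neg (neg {x = x} {x′} r l) = Lin-cast (eq x _) (eq x′ _) (pos r (Lin-neg l))
  where eq : ∀ x z → + x + - z ≡ - (- + x + z)
        eq x z = lemma (+ x) z
          where lemma : ∀ x z → x + - z ≡ - (- x + z)
                lemma = solve-∀

Lin-* : ∀ k → Lin R c z z′ → Lin R (k ℕ.* c) (+ k * z) (+ k * z′)
Lin-* {z = z} {z′ = z′} zero    l = Lin-cast (sym (ℤ.*-zeroˡ z)) (sym (ℤ.*-zeroˡ z′)) nil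
Lin-* {z = z} {z′ = z′} (suc k) l = Lin-cast (eq z) (eq z′) (Lin-+ l (Lin-* k l))
  where eq : ∀ z → z + + k * z ≡ + suc k * z
        eq z = trans (lemma z (+ k)) (cong (_* z) (sym (ℤ.pos-+ 1 k)))
          where lemma : ∀ z k → z + k * z ≡ (1ℤ + k) * z
                lemma = solve-∀

Lin-≋ : ∀ {n} → (∀ {x x′} → R x x′ → + x ≋[ n ] + x′) → Lin R c z z′ → z ≋[ n ] z′
Lin-≋ f nil       = ≋-refl
Lin-≋ f (skip l)  = Lin-≋ f l
Lin-≋ f (pos r l) = +-cong (f r) (Lin-≋ f l)
Lin-≋ f (neg r l) = +-cong (neg-cong (f r)) (Lin-≋ f l)

-- Partial isomorphism of bounded complexity. The pair `one` makes integer constants available in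
-- forms. Residues are asked of generators alone, since `Lin-≋` extends them to forms.
record PE (C D : ℕ) (R : Rel) : Set where
  field
    one  : R 1 1
    sign : ∀ {z z′} → Lin R C z z′ → (0ℤ ≤ z) ⇔ (0ℤ ≤ z′)
    res  : ∀ {x x′} → R x x′ → + x ≋[ D ] + x′
open PE

PE-flip : ∀ {C D} → PE C D R → PE C D (λ x x′ → R x′ x)
PE-flip e .one    = e .one
PE-flip e .sign l = ⇔-sym (e .sign (Lin-flip l))
PE-flip e .res r  = ≋-sym (e .res r)

PE-weaken : ∀ {C C′ D} L → C ℕ.≤ C′ → PE C′ (L ℕ.* D) R → PE C D R
PE-weaken L le e .one    = e .one
PE-weaken L le e .sign l = e .sign (Lin-weaken le l)
PE-weaken {D = D} L le e .res r = ≋-∣ L D (e .res r)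

infixl 5 _▸_
_▸_ : Rel → ℕ × ℕ → Rel
(R ▸ (y , y′)) x x′ = R x x′ ⊎ (x ≡ y × x′ ≡ y′)

-- The occurrences of the new pair are collected in the coefficient `κ`. Each is replaced by `skip`,
-- so the remaining form keeps the weight `c`.
Lin-split : ∀ {y y′} → Lin (R ▸ (y , y′)) c z z′ →
            Σ ℤ λ κ → Σ ℤ λ f → Σ ℤ λ f′ →
            Lin R c f f′ × z ≡ f + κ * + y × z′ ≡ f′ + κ * + y′ × ℤ.∣ κ ∣ ℕ.≤ c
Lin-split nil = 0ℤ , 0ℤ , 0ℤ , nil , refl , refl , z≤n
Lin-split (skip l) with κ , f , f′ , m , e , e′ , b ← Lin-split l =
  κ , f , f′ , skip m , e , e′ , ℕ.m≤n⇒m≤1+n b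
Lin-split (pos {x = x} {x′} (inj₁ r) l) with κ , f , f′ , m , refl , refl , b ← Lin-split l =
  κ , _ , _ , pos r m , sym (ℤ.+-assoc (+ x) f _) , sym (ℤ.+-assoc (+ x′) f′ _) , ℕ.m≤n⇒m≤1+n b
Lin-split (neg {x = x} {x′} (inj₁ r) l) with κ , f , f′ , m , refl , refl , b ← Lin-split l =
  κ , _ , _ , neg r m , sym (ℤ.+-assoc (- + x) f _) , sym (ℤ.+-assoc (- + x′) f′ _) , ℕ.m≤n⇒m≤1+n b
Lin-split {y = y} {y′} (pos (inj₂ (refl , refl)) l) with κ , f , f′ , m , refl , refl , b ← Lin-split l =
  1ℤ + κ , f , f′ , skip m , lemma (+ y) f κ , lemma (+ y′) f′ κ ,
  ℕ.≤-trans (ℤ.∣i+j∣≤∣i∣+∣j∣ 1ℤ κ) (s≤s b)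
  where lemma : ∀ y f κ → y + (f + κ * y) ≡ f + (1ℤ + κ) * y
        lemma = solve-∀
Lin-split {y = y} {y′} (neg (inj₂ (refl , refl)) l) with κ , f , f′ , m , refl , refl , b ← Lin-split l =
  - 1ℤ + κ , f , f′ , skip m , lemma (+ y) f κ , lemma (+ y′) f′ κ ,
  ℕ.≤-trans (ℤ.∣i+j∣≤∣i∣+∣j∣ (- 1ℤ) κ) (s≤s b)
  where lemma : ∀ y f κ → - y + (f + κ * y) ≡ f + (- 1ℤ + κ) * y
        lemma = solve-∀

-- `P` need not be decidable. If there were no least witness, `go` would descend through ever
-- smaller ones, which the bound `b` makes impossible.
¬¬least : (P : ℕ → Set) → ∀ n → P n → ¬ ¬ Σ ℕ λ m → P m × (∀ k → P k → m ℕ.≤ k)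
¬¬least P n pn none = go n n ℕ.≤-refl pn
  where
  go : ∀ b m → m ℕ.≤ b → P m → _
  go b m m≤b pm = none (m , pm , λ k pk → ℕ.≮⇒≥ λ k<m → below b m m≤b k k<m pk)
    where
    below : ∀ b m → m ℕ.≤ b → ∀ k → k ℕ.< m → P k → _
    below (suc b) m m≤b k k<m pk = go b k (ℕ.≤-pred (ℕ.≤-trans k<m m≤b)) pk
    below zero    m m≤b k k<m pk = contradiction (ℕ.≤-trans k<m m≤b) λ ()

nonneg-scale : ∀ j a → (0ℤ ≤ a) ⇔ (0ℤ ≤ + suc j * a)
nonneg-scale j a = mk⇔
  (λ h → subst (_≤ + suc j * a) (ℤ.*-zeroʳ (+ suc j)) (ℤ.*-monoˡ-≤-nonNeg (+ suc j) h))
  (λ h → ℤ.*-cancelˡ-≤-pos 0ℤ a (+ suc j) (subst (_≤ + suc j * a) (sym (ℤ.*-zeroʳ (+ suc j))) h))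

-- Integrality turns negation of a sign condition into another sign condition; this makes a negative
-- coefficient of `y` positive.
nonneg-compl : ∀ a → (0ℤ ≤ a) ⇔ (¬ 0ℤ ≤ - a - 1ℤ)
nonneg-compl (+ n)      = mk⇔ (λ _ h → absurd n h) (λ _ → +≤+ z≤n)
  where absurd : ∀ n → ¬ 0ℤ ≤ - + n - 1ℤ
        absurd zero    ()
        absurd (suc n) ()
nonneg-compl (-[1+ n ]) = mk⇔ (λ ()) (λ h → contradiction (+≤+ z≤n) h)

¬-⇔ : {A B : Set} → A ⇔ B → (¬ A) ⇔ (¬ B)
¬-⇔ h = mk⇔ (_∘ from h) (_∘ to h)

≡-⇔ : ∀ {a b} → a ≡ b → (0ℤ ≤ a) ⇔ (0ℤ ≤ b)
≡-⇔ refl = mk⇔ (λ x → x) (λ x → x)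

-- Multiplying by L / ∣ κ ∣ reduces the sign of a form f + κ y to that of some e + L y.
module Reduction (C L : ℕ) (div : ∀ k → suc k ℕ.≤ C → Σ ℕ λ j → suc j ℕ.* suc k ≡ L)
                 {R} (unit : R 1 1) {y y′ : ℤ}
                 (base : ∀ {e e′} → Lin R (L ℕ.* suc C) e e′ → (0ℤ ≤ e + + L * y) ⇔ (0ℤ ≤ e′ + + L * y′))
                 (plain : ∀ {f f′} → Lin R C f f′ → (0ℤ ≤ f) ⇔ (0ℤ ≤ f′)) where

  private
    j≤L : ∀ j k → suc j ℕ.* suc k ≡ L → suc j ℕ.≤ L
    j≤L j k eq = ℕ.≤-trans (ℕ.m≤m*n (suc j) (suc k)) (ℕ.≤-reflexive eq)

    up : ∀ j k y f → suc j ℕ.* suc k ≡ L → + suc j * (f + + suc k * y) ≡ + suc j * f + + L * y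
    up j k y f refl = trans (lemma (+ suc j) (+ suc k) f y)
      (cong (λ z → + suc j * f + z * y) (sym (ℤ.pos-* (suc j) (suc k))))
      where lemma : ∀ j k f y → j * (f + k * y) ≡ j * f + j * k * y
            lemma = solve-∀

    down : ∀ j k y f → suc j ℕ.* suc k ≡ L →
           + suc j * (- (f + -[1+ k ] * y) - 1ℤ) ≡ + suc j * (- 1ℤ + - f) + + L * y
    down j k y f eq = trans (cong (+ suc j *_) (lemma f (+ suc k) y)) (up j k y (- 1ℤ + - f) eq)
      where lemma : ∀ f k y → - (f + - k * y) - 1ℤ ≡ - 1ℤ + - f + k * y
            lemma = solve-∀

  reduce : ∀ κ {f f′} → ℤ.∣ κ ∣ ℕ.≤ C → Lin R C f f′ → (0ℤ ≤ f + κ * y) ⇔ (0ℤ ≤ f′ + κ * y′)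
  reduce (+ zero) {f} {f′} b l = ≡-⇔ (sym (eq f′ y′)) ⇔-∘ (plain l ⇔-∘ ≡-⇔ (eq f y))
    where eq : ∀ f y → f + 0ℤ * y ≡ f
          eq = solve-∀
  reduce (+ suc k) {f} {f′} b l with j , eq ← div k b =
    ⇔-sym (nonneg-scale j _)
    ⇔-∘ (≡-⇔ (sym (up j k y′ f′ eq))
    ⇔-∘ (base (Lin-weaken (ℕ.*-mono-≤ (j≤L j k eq) (ℕ.n≤1+n C)) (Lin-* (suc j) l))
    ⇔-∘ (≡-⇔ (up j k y f eq)
    ⇔-∘ nonneg-scale j _)))
  reduce (-[1+ k ]) {f} {f′} b l with j , eq ← div k b =
    ⇔-sym (nonneg-compl _) ⇔-∘ (¬-⇔ (
    ⇔-sym (nonneg-scale j _)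
    ⇔-∘ (≡-⇔ (sym (down j k y′ f′ eq))
    -- The constant -1 is the pair (1, 1) taken negatively; it accounts for `suc C` instead of `C`
    -- in the weight.
    ⇔-∘ (base (Lin-weaken (ℕ.*-monoˡ-≤ (suc C) (j≤L j k eq)) (Lin-* (suc j) (neg unit (Lin-neg l))))
    ⇔-∘ (≡-⇔ (down j k y f eq)
    ⇔-∘ nonneg-scale j _)))) ⇔-∘ nonneg-compl _)

module Extension (C D : ℕ) .{{_ : NonZero D}} where

  -- `C !` is a common multiple of all possible coefficients of the new exponent, and `W` is the
  -- weight of a form after scaling to this multiple.
  L W : ℕ
  L = C !
  W = L ℕ.* suc C

  instance
    L≢0 : NonZero L
    L≢0 = ℕ._!≢0 C

  -- Two summands `W` pay for the difference of two scaled forms, and `L * D` pays for adding a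
  -- remainder modulo `D⁺` as copies of 1. The factor `L` in the modulus is lost on dividing by `L`.
  C⁺ D⁺ : ℕ
  C⁺ = W ℕ.+ W ℕ.+ L ℕ.* D
  D⁺ = L ℕ.* D

  instance
    D⁺≢0 : NonZero D⁺
    D⁺≢0 = ℕ.m*n≢0 L D

  C≤C⁺ : C ℕ.≤ C⁺
  C≤C⁺ = ℕ.≤-trans (ℕ.n≤1+n C) (ℕ.≤-trans (ℕ.m≤n*m (suc C) L)
           (ℕ.≤-trans (ℕ.m≤m+n W W) (ℕ.m≤m+n (W ℕ.+ W) D⁺)))

  private
    div : ∀ k → suc k ℕ.≤ C → Σ ℕ λ j → suc j ℕ.* suc k ≡ L
    div k k<C with ℕ.∣-trans (ℕ.m∣m*n {suc k} (k !)) (ℕ.m≤n⇒m!∣n! k<C)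
    ... | ℕ.divides zero eq    = contradiction eq (ℕ.≢-nonZero⁻¹ L)
    ... | ℕ.divides (suc j) eq = j , sym eq

  module _ {R : Rel} (pe : PE C⁺ D⁺ R) (y : ℕ) where

    private
      Value : ℕ → Set
      Value n = Σ ℤ λ e → Σ ℤ λ e′ → Lin R W e e′ × e + + L * + y ≡ + n

    -- n is the distance from L y down to the nearest form - e₀, so that L y
    -- may be moved to - e₀′ + n % D⁺ on the other side.
    module Nearest (n : ℕ) (e₀ e₀′ : ℤ) (l₀ : Lin R W e₀ e₀′) (eq₀ : e₀ + + L * + y ≡ + n)
                   (least : ∀ m → Value m → n ℕ.≤ m) where

      q : ℕ
      q = n ℕ.% D⁺

      shifted : - e₀′ + + q ≋[ D⁺ ] + L * + y
      shifted = ≋-trans (+-cong (neg-cong (≋-sym (Lin-≋ (pe .res) l₀))) (≋-sym (%-≋ n)))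
                        (≋-reflexive (trans (cong (λ a → - e₀ + a) (sym eq₀)) (lemma e₀ _)))
        where lemma : ∀ e a → - e + (e + a) ≡ a
              lemma = solve-∀

      -- By `shifted`, `- e₀′ + q` is `L y` plus a multiple of `L D`. Hence it is divisible by `L`,
      -- with a quotient congruent to `y` modulo `D`.
      ŷ : ℤ
      ŷ = + y + _≋[_]_.quot shifted * + D

      eq-ŷ : - e₀′ + + q ≡ + L * ŷ
      eq-ŷ = trans (_≋[_]_.proof shifted)
               (trans (cong (λ a → + L * + y + j * a) (ℤ.pos-* L D)) (lemma (+ L) (+ y) j (+ D)))
        where j = _≋[_]_.quot shifted
              lemma : ∀ l y j d → l * y + j * (l * d) ≡ l * (y + j * d)
              lemma = solve-∀

      -- Forwards, minimality of `n` gives `e₀ ≤ e`, which transports to `e₀′ ≤ e′`, and `q` is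
      -- nonnegative. Backwards, the sign of `e - e₀ + q` transports, and `q ≤ n`.
      base : ∀ {e e′} → Lin R W e e′ → (0ℤ ≤ e + + L * + y) ⇔ (0ℤ ≤ e′ + + L * ŷ)
      base {e} {e′} l = mk⇔ fwd bwd
        where
        diff : Lin R (W ℕ.+ W) (e - e₀) (e′ - e₀′)
        diff = Lin-+ l (Lin-neg l₀)

        above : ∀ z → e + + L * + y ≡ z → 0ℤ ≤ z → 0ℤ ≤ e - e₀
        above (+ m) eq _ = subst (0ℤ ≤_)
          (trans (cong₂ _-_ (sym eq) (sym eq₀)) (lemma e e₀ _)) (ℤ.i≤j⇒0≤j-i (+≤+ (least m (e , e′ , l , eq))))
          where lemma : ∀ e e₀ a → e + a - (e₀ + a) ≡ e - e₀
                lemma = solve-∀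

        moved : e′ - e₀′ + + q ≡ e′ + + L * ŷ
        moved = trans (ℤ.+-assoc e′ (- e₀′) (+ q)) (cong (λ a → e′ + a) eq-ŷ)

        fwd : 0ℤ ≤ e + + L * + y → 0ℤ ≤ e′ + + L * ŷ
        fwd h = subst (0ℤ ≤_) moved
          (ℤ.+-mono-≤ (to (pe .sign (Lin-weaken (ℕ.m≤m+n (W ℕ.+ W) D⁺) diff)) (above _ refl h)) (+≤+ {0} {q} z≤n))

        with-q : Lin R C⁺ (e - e₀ + + q) (e′ - e₀′ + + q)
        with-q = Lin-weaken (ℕ.+-monoʳ-≤ (W ℕ.+ W) (ℕ.<⇒≤ (ℕ.m%n<n n D⁺)))
          (Lin-+ diff (subst₂ (λ c a → Lin R c a a) (ℕ.*-identityʳ q) (ℤ.*-identityʳ (+ q))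
            (Lin-* q (pos (pe .one) nil))))

        bwd : 0ℤ ≤ e′ + + L * ŷ → 0ℤ ≤ e + + L * + y
        bwd h = subst (0ℤ ≤_) (trans (cong (λ a → e - e₀ + a) (sym eq₀)) (lemma e e₀ _))
          (ℤ.≤-trans (from (pe .sign with-q) (subst (0ℤ ≤_) (sym moved) h))
                     (ℤ.+-monoʳ-≤ (e - e₀) (+≤+ (ℕ.m%n≤m n D⁺))))
          where lemma : ∀ e e₀ a → e - e₀ + (e₀ + a) ≡ e + a
                lemma = solve-∀

      ŷ≥0 : 0ℤ ≤ ŷ
      ŷ≥0 = ℤ.*-cancelˡ-≤-pos 0ℤ ŷ (+ L) {{ℤ.positive (ℤ.+<+ (ℕ.>-nonZero⁻¹ L))}}
        (subst₂ _≤_ (sym (ℤ.*-zeroʳ (+ L))) (ℤ.+-identityˡ _)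
          (to (base (Lin-zero W)) (subst (0ℤ ≤_) (sym (ℤ.+-identityˡ _))
            (subst (0ℤ ≤_) (ℤ.pos-* L y) (+≤+ z≤n)))))

      extended : Σ ℕ λ y′ → PE C D (R ▸ (y , y′))
      extended = y′ , record { one = inj₁ (pe .one) ; sign = sign′ ; res = res′ }
        where
        y′ = ℤ.∣ ŷ ∣
        ŷ≡ : ŷ ≡ + y′
        ŷ≡ = sym (ℤ.0≤i⇒+∣i∣≡i ŷ≥0)

        open Reduction C L div (pe .one) {+ y} {+ y′}
          (λ {e} {e′} l → subst (λ a → (0ℤ ≤ e + + L * + y) ⇔ (0ℤ ≤ e′ + + L * a)) ŷ≡ (base l))
          (λ l → pe .sign (Lin-weaken C≤C⁺ l))

        sign′ : ∀ {z z′} → Lin (R ▸ (y , y′)) C z z′ → (0ℤ ≤ z) ⇔ (0ℤ ≤ z′)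
        sign′ l with κ , f , f′ , m , refl , refl , b ← Lin-split l = reduce κ b m

        res′ : ∀ {x x′} → (R ▸ (y , y′)) x x′ → + x ≋[ D ] + x′
        res′ (inj₁ r)             = ≋-∣ L D (pe .res r)
        res′ (inj₂ (refl , refl)) = ≋-sym (by (_≋[_]_.quot shifted) (sym ŷ≡))

    extend : ¬ ¬ Σ ℕ λ y′ → PE C D (R ▸ (y , y′))
    -- The zero form has the nonnegative value `L y`, which starts the search for the least one.
    extend = ¬¬least Value (L ℕ.* y) (0ℤ , 0ℤ , Lin-zero W , trans (ℤ.+-identityˡ _) (sym (ℤ.pos-* L y)))
      >>= λ { (n , (e₀ , e₀′ , l₀ , eq₀) , least) → return (Nearest.extended n e₀ e₀′ l₀ eq₀ least) }

mutual
  -- Chosen so that `PEₙ n` survives `n` further extensions. At the end weight 3 remains, enough to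
  -- compare `i + j` with `k`, and the modulus is trivial.
  bound modulus : ℕ → ℕ
  bound zero      = 3
  bound (suc n)   = Extension.C⁺ (bound n) (modulus n) {{modulus≢0 n}}
  modulus zero    = 1
  modulus (suc n) = Extension.D⁺ (bound n) (modulus n) {{modulus≢0 n}}

  modulus≢0 : ∀ n → NonZero (modulus n)
  modulus≢0 zero    = _
  modulus≢0 (suc n) = Extension.D⁺≢0 (bound n) (modulus n) {{modulus≢0 n}}

PEₙ : ℕ → Rel → Set
PEₙ n = PE (bound n) (modulus n)

PEₙ-extend : ∀ n → PEₙ (suc n) R → ∀ y → ¬ ¬ Σ ℕ λ y′ → PEₙ n (R ▸ (y , y′))
PEₙ-extend n = Extension.extend (bound n) (modulus n) {{modulus≢0 n}}

PEₙ-pred : ∀ n → PEₙ (suc n) R → PEₙ n R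
PEₙ-pred n = PE-weaken (bound n !) (Extension.C≤C⁺ (bound n) (modulus n) {{modulus≢0 n}})

PEₙ-drop : ∀ k {n} → PEₙ (k ℕ.+ n) R → PEₙ n R
PEₙ-drop zero    pe = pe
PEₙ-drop (suc k) {n} pe = PEₙ-drop k {n} (PEₙ-pred (k ℕ.+ n) pe)

PEₙ-base : ∀ n → PEₙ n R → PE 3 1 R
PEₙ-base n pe = PEₙ-drop n {0} (subst (λ k → PEₙ k _) (sym (ℕ.+-identityʳ n)) pe)

-- The form `x - x` is nonnegative, and so are its images for both orders of the two partners of
-- `x`. Thus `R` is functional and, by `PE-flip`, injective.
PE-≡ : ∀ {x x′ y y′} → PE 3 1 R → R x x′ → R y y′ → x ≡ y → x′ ≡ y′
PE-≡ {R = R} {x = x} pe r s refl =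
  ℕ.≤-antisym (half r s) (half s r)
  where
  half : ∀ {a b} → R x b → R x a → b ℕ.≤ a
  half {a} {b} r s = ℤ.drop‿+≤+ (ℤ.0≤i-j⇒j≤i (subst (0ℤ ≤_) (lemma (+ a) (+ b))
    (to (pe .sign (pos s (neg r (skip nil)))) (subst (0ℤ ≤_) (lemma′ (+ x)) ℤ.≤-refl))))
    where lemma : ∀ a b → a + (- b + 0ℤ) ≡ a - b
          lemma = solve-∀
          lemma′ : ∀ x → 0ℤ ≡ x + (- x + 0ℤ)
          lemma′ = solve-∀

-- The equation is a pair of inequalities between forms of weight three, transported separately.
PE-+ : ∀ {i i′ j j′ k k′} → PE 3 1 R → R i i′ → R j j′ → R k k′ → i ℕ.+ j ≡ k → i′ ℕ.+ j′ ≡ k′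
PE-+ {i = i} {i′} {j} {j′} {_} {k′} pe ri rj rk refl = ℤ.+-injective (trans (ℤ.pos-+ i′ j′)
  (ℤ.≤-antisym
    (ℤ.0≤i-j⇒j≤i (subst (0ℤ ≤_) (lemma₁ (+ i′) (+ j′) (+ k′))
      (to (pe .sign (neg ri (neg rj (pos rk nil))))
        (subst (0ℤ ≤_) (trans (zero₁ (+ i) (+ j)) (cong (λ a → - + i + (- + j + (a + 0ℤ))) (sym (ℤ.pos-+ i j)))) ℤ.≤-refl))))
    (ℤ.0≤i-j⇒j≤i (subst (0ℤ ≤_) (lemma₂ (+ i′) (+ j′) (+ k′))
      (to (pe .sign (pos ri (pos rj (neg rk nil))))
        (subst (0ℤ ≤_) (trans (zero₂ (+ i) (+ j)) (cong (λ a → + i + (+ j + (- a + 0ℤ))) (sym (ℤ.pos-+ i j)))) ℤ.≤-refl))))))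
  where
  lemma₁ : ∀ i j k → - i + (- j + (k + 0ℤ)) ≡ k - (i + j)
  lemma₁ = solve-∀
  lemma₂ : ∀ i j k → i + (j + (- k + 0ℤ)) ≡ i + j - k
  lemma₂ = solve-∀
  zero₁ : ∀ i j → 0ℤ ≡ - i + (- j + (i + j + 0ℤ))
  zero₁ = solve-∀
  zero₂ : ∀ i j → 0ℤ ≡ i + (j + (- (i + j) + 0ℤ))
  zero₂ = solve-∀


-- Finitely supported functions modulo p

-- Integer values keep the ring solver usable; reduction modulo `p` is left to `≃` and finite
-- support to `Finite`.
F : Set
F = ℕ → ℤ

comb : ∀ {n} → (Fin n → ℤ) → (Fin n → F) → F
comb {zero}  l v y = 0ℤ
comb {suc n} l v y = l Fin.zero * v Fin.zero y + comb (l ∘ Fin.suc) (v ∘ Fin.suc) y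

comb-linear : ∀ {n} a b (l m : Fin n → ℤ) v y →
              comb (λ i → a * l i + b * m i) v y ≡ a * comb l v y + b * comb m v y
comb-linear {zero}  a b l m v y = sym (cong₂ _+_ (ℤ.*-zeroʳ a) (ℤ.*-zeroʳ b))
comb-linear {suc n} a b l m v y =
  trans (cong (λ c → (a * l Fin.zero + b * m Fin.zero) * v Fin.zero y + c)
          (comb-linear a b (l ∘ Fin.suc) (m ∘ Fin.suc) (v ∘ Fin.suc) y))
        (lemma a b (l Fin.zero) (m Fin.zero) (v Fin.zero y) _ _)
  where lemma : ∀ a b l m v c d → (a * l + b * m) * v + (a * c + b * d) ≡ a * (l * v + c) + b * (m * v + d)
        lemma = solve-∀

comb-zero : ∀ {n} (l : Fin n → ℤ) v y → (∀ i → l i ≡ 0ℤ) → comb l v y ≡ 0ℤ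
comb-zero {zero}  l v y h = refl
comb-zero {suc n} l v y h rewrite h Fin.zero | comb-zero (l ∘ Fin.suc) (v ∘ Fin.suc) y (h ∘ Fin.suc) = refl

unit : ∀ {n} → Fin n → Fin n → ℤ
unit Fin.zero    Fin.zero    = 1ℤ
unit Fin.zero    (Fin.suc j) = 0ℤ
unit (Fin.suc i) Fin.zero    = 0ℤ
unit (Fin.suc i) (Fin.suc j) = unit i j

comb-unit : ∀ {n} i (v : Fin n → F) y → comb (unit i) v y ≡ v i y
comb-unit Fin.zero v y
  rewrite comb-zero (λ _ → 0ℤ) (v ∘ Fin.suc) y (λ _ → refl) = trans (ℤ.+-identityʳ _) (ℤ.*-identityˡ _)
comb-unit (Fin.suc i) v y = trans (ℤ.+-identityˡ _) (comb-unit i (v ∘ Fin.suc) y)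

comb-cong : ∀ {n p} (l m : Fin n → ℤ) v w y → (∀ i → l i ≋[ p ] m i) → (∀ i → v i y ≋[ p ] w i y) →
            comb l v y ≋[ p ] comb m w y
comb-cong {zero}  l m v w y h k = ≋-refl
comb-cong {suc n} l m v w y h k = +-cong (*-cong (h Fin.zero) (k Fin.zero))
  (comb-cong (l ∘ Fin.suc) (m ∘ Fin.suc) (v ∘ Fin.suc) (w ∘ Fin.suc) y (h ∘ Fin.suc) (k ∘ Fin.suc))

comb-++ : ∀ m {k} (l : Fin (m ℕ.+ k) → ℤ) (v : Fin (m ℕ.+ k) → F) y →
          comb l v y ≡ comb (λ i → l (i Fin.↑ˡ k)) (λ i → v (i Fin.↑ˡ k)) y
                     + comb (λ j → l (m Fin.↑ʳ j)) (λ j → v (m Fin.↑ʳ j)) y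
comb-++ zero    l v y = sym (ℤ.+-identityˡ _)
comb-++ (suc m) l v y = trans (cong (λ c → l Fin.zero * v Fin.zero y + c) (comb-++ m (l ∘ Fin.suc) (v ∘ Fin.suc) y))
  (sym (ℤ.+-assoc (l Fin.zero * v Fin.zero y) _ _))

-- Reduces a congruence to a ring identity in which `k` is the multiplier of a known congruence.
≋-via : ∀ {n a b c d} k → c ≋[ n ] d → a ≡ b + k * (c - d) → a ≋[ n ] b
≋-via {n} {a} {b} {c} {d} k (by q refl) e = by (k * q) (trans e (lemma b k d q (+ n)))
  where lemma : ∀ b k d q n → b + k * (d + q * n - d) ≡ b + k * q * n
        lemma = solve-∀

%ℕ-≋ : ∀ n .{{_ : NonZero n}} a → a ≋[ n ] + (a ℤ.%ℕ n)
%ℕ-≋ n a = by (a ℤ./ℕ n) (ℤ.a≡a%ℕn+[a/ℕn]*n a n)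

≋-small : ∀ {n a b} .{{_ : NonZero n}} → a ℕ.< n → b ℕ.< n → + a ≋[ n ] + b → a ≡ b
≋-small {n} {a} {b} a<n b<n h = go h
  where
  wrap : ∀ {a b} k → a ℕ.< n → b ℕ.< n → + a ≡ + b + + k * + n → a ≡ b
  wrap {a} {b} k a<n b<n e = trans (sym (ℕ.m<n⇒m%n≡m a<n))
    (trans (cong (ℕ._% n) (ℤ.+-injective (trans e
      (trans (cong (λ c → + b + c) (sym (ℤ.pos-* k n))) (sym (ℤ.pos-+ b (k ℕ.* n)))))))
    (trans (ℕ.[m+kn]%n≡m%n b k n) (ℕ.m<n⇒m%n≡m b<n)))
  go : + a ≋[ n ] + b → a ≡ b
  go (by (+ k) e)      = wrap k a<n b<n e
  go (by (-[1+ k ]) e) = sym (wrap (suc k) b<n a<n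
    (trans (lemma (+ b) (+ suc k) (+ n)) (cong (λ c → c + + suc k * + n) (sym e))))
    where lemma : ∀ b k n → b ≡ b + (- k) * n + k * n
          lemma = solve-∀

-- The remainder of `k` is positive and below the prime `p`, hence coprime to it. The two Bézout
-- identities give inverses of opposite sign.
inverse : ∀ {p} .{{_ : NonZero p}} → Prime p → ∀ k → ¬ k ≋[ p ] 0ℤ → Σ ℤ λ j → j * k ≋[ p ] 1ℤ
inverse {p} pr k k≢0 = go (k ℤ.%ℕ p) refl (ℤ.n%ℕd<d k p)
  where
  go : ∀ m → k ℤ.%ℕ p ≡ m → m ℕ.< p → Σ ℤ λ j → j * k ≋[ p ] 1ℤ
  go zero    e m<p = contradiction (subst (λ m → k ≋[ p ] + m) e (%ℕ-≋ p k)) k≢0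
  go (suc m) e m<p with ℕ.coprime-Bézout (ℕ.prime⇒coprime pr m<p)
  ... | Bézout.-+ x y eq = + y , ≋-trans (*-congʳ (+ y) k≋) (by (+ x)
    (trans (sym (ℤ.pos-* y (suc m))) (trans (cong +_ (sym eq)) (trans (ℤ.pos-+ 1 (x ℕ.* p)) (cong (λ c → 1ℤ + c) (ℤ.pos-* x p))))))
    where k≋ : k ≋[ p ] + suc m
          k≋ = subst (λ m → k ≋[ p ] + m) e (%ℕ-≋ p k)
  ... | Bézout.+- x y eq = - + y , ≋-trans (*-congʳ (- + y) k≋) (by (- + x)
    (trans (lemma (+ y) (+ suc m)) (trans (cong (λ c → 1ℤ - c)
      (trans (cong (λ c → 1ℤ + c) (sym (ℤ.pos-* y (suc m))))
        (trans (sym (ℤ.pos-+ 1 (y ℕ.* suc m))) (trans (cong +_ eq) (ℤ.pos-* x p))))) (lemma′ (+ x) (+ p)))))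
    where k≋ : k ≋[ p ] + suc m
          k≋ = subst (λ m → k ≋[ p ] + m) e (%ℕ-≋ p k)
          lemma : ∀ y m → (- y) * m ≡ 1ℤ - (1ℤ + y * m)
          lemma = solve-∀
          lemma′ : ∀ x p → 1ℤ - x * p ≡ 1ℤ + (- x) * p
          lemma′ = solve-∀

-- Sums of monomials and their transport along a matching of exponents.

module Span (p : ℕ) .{{p≢0 : NonZero p}} where

  infix 4 _≃_
  _≃_ : F → F → Set
  f ≃ g = ∀ y → f y ≋[ p ] g y

  𝟘 : F
  𝟘 _ = 0ℤ

  ⟦_⟧ : Poly p → F
  ⟦ a ⟧ y = + coeff p y a

  ⟦_⟧* : ∀ {n} → Vector (Poly p) n → Fin n → F
  ⟦ e ⟧* i = ⟦ e i ⟧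

  mono : ℤ → ℕ → F
  mono c x y = c * + δ p y x

  δ-refl : ∀ x → δ p x x ≡ 1
  δ-refl zero    = refl
  δ-refl (suc x) = δ-refl x

  δ-≢ : ∀ {x y} → x ≢ y → δ p x y ≡ 0
  δ-≢ {zero}  {zero}  x≢y = contradiction refl x≢y
  δ-≢ {zero}  {suc y} x≢y = refl
  δ-≢ {suc x} {zero}  x≢y = refl
  δ-≢ {suc x} {suc y} x≢y = δ-≢ (x≢y ∘ cong suc)

  poly : ∀ {s} → Vec (ℤ × ℕ) s → F
  poly []            y = 0ℤ
  poly ((c , x) ∷ t) y = mono c x y + poly t y

  poly-++ : ∀ {s t} (u : Vec (ℤ × ℕ) s) (v : Vec (ℤ × ℕ) t) y → poly (u ++ v) y ≡ poly u y + poly v y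
  poly-++ []            v y = sym (ℤ.+-identityˡ _)
  poly-++ ((c , x) ∷ u) v y = trans (cong (λ a → mono c x y + a) (poly-++ u v y)) (sym (ℤ.+-assoc (mono c x y) _ _))

  scale : ∀ {s} → ℤ → Vec (ℤ × ℕ) s → Vec (ℤ × ℕ) s
  scale k = map λ { (c , x) → k * c , x }

  poly-scale : ∀ {s} k (u : Vec (ℤ × ℕ) s) y → poly (scale k u) y ≡ k * poly u y
  poly-scale k []            y = sym (ℤ.*-zeroʳ k)
  poly-scale k ((c , x) ∷ u) y = trans (cong (λ a → k * c * + δ p y x + a) (poly-scale k u y)) (lemma k c _ _)
    where lemma : ∀ k c d a → k * c * d + k * a ≡ k * (c * d + a)
          lemma = solve-∀

  poly-support : ∀ {s} (u : Vec (ℤ × ℕ) s) y → (∀ i → proj₂ (lookup u i) ≢ y) → poly u y ≡ 0ℤ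
  poly-support []            y h = refl
  poly-support ((c , x) ∷ u) y h rewrite δ-≢ (h Fin.zero ∘ sym) | poly-support u y (h ∘ Fin.suc) =
    trans (ℤ.+-identityʳ _) (ℤ.*-zeroʳ c)

  -- Zero coefficients and repeated exponents are allowed, so `s` only bounds the number of
  -- monomials from above.
  Short : ℕ → F → Set
  Short s f = Σ (Vec (ℤ × ℕ) s) λ u → f ≃ poly u

  Short-resp : ∀ {s f g} → f ≃ g → Short s f → Short s g
  Short-resp h (u , e) = u , λ y → ≋-trans (≋-sym (h y)) (e y)

  Short-+ : ∀ {s t f g} → Short s f → Short t g → Short (s ℕ.+ t) (λ y → f y + g y)
  Short-+ (u , e) (v , d) = u ++ v , λ y → ≋-trans (+-cong (e y) (d y)) (≋-reflexive (sym (poly-++ u v y)))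

  Short-* : ∀ {s f} k → Short s f → Short s (λ y → k * f y)
  Short-* k (u , e) = scale k u , λ y → ≋-trans (*-congʳ k (e y)) (≋-reflexive (sym (poly-scale k u y)))

  Short-𝟘 : ∀ s → Short s 𝟘
  Short-𝟘 zero    = [] , λ y → ≋-refl
  Short-𝟘 (suc s) with u , e ← Short-𝟘 s = (0ℤ , 0) ∷ u , λ y → ≋-trans (e y) (≋-reflexive (sym (ℤ.+-identityˡ _)))

  Short-pad : ∀ {s f} t → Short s f → Short (s ℕ.+ t) f
  Short-pad t h = Short-resp (λ y → ≋-reflexive (ℤ.+-identityʳ _)) (Short-+ h (Short-𝟘 t))

  -- Each of the `s + 1` places from `B` on would be an exponent of `u`, which has only `s`.
  ¬Short : ∀ {s f} B → (∀ j → j ℕ.≤ s → ¬ f (B ℕ.+ j) ≋[ p ] 0ℤ) → ¬ Short s f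
  ¬Short {s} {f} B h (u , e) = clash (Fin.pigeonhole (ℕ.n<1+n s) (proj₁ ∘ hit))
    where
    hit : ∀ (j : Fin (suc s)) → Σ (Fin s) λ i → proj₂ (lookup u i) ≡ B ℕ.+ toℕ j
    hit j with Fin.any? (λ i → proj₂ (lookup u i) ℕ.≟ B ℕ.+ toℕ j)
    ... | yes q = q
    ... | no ¬q = contradiction
      (≋-trans (e (B ℕ.+ toℕ j)) (≋-reflexive (poly-support u _ λ i q → ¬q (i , q))))
      (h (toℕ j) (ℕ.≤-pred (Fin.toℕ<n j)))
    clash : ¬ ∃₂ λ i j → i Fin.< j × proj₁ (hit i) ≡ proj₁ (hit j)
    clash (i , j , i<j , eq) = ℕ.<⇒≢ i<j (ℕ.+-cancelˡ-≡ B (toℕ i) (toℕ j)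
      (trans (sym (proj₂ (hit i))) (trans (cong (proj₂ ∘ lookup u) eq) (proj₂ (hit j)))))

  -- Graph of the linear correspondence between spans of monomials induced by `R`, closed under `≃`
  -- and without a bound on the length.
  data Sp (R : Rel) (f f′ : F) : Set where
    nil  : f ≃ 𝟘 → f′ ≃ 𝟘 → Sp R f f′
    cons : ∀ {x x′ g g′} c → R x x′ → Sp R g g′ →
           f ≃ (λ y → mono c x y + g y) → f′ ≃ (λ y → mono c x′ y + g′ y) → Sp R f f′

  Sp-resp : ∀ {f f′ g g′} → f ≃ g → f′ ≃ g′ → Sp R f f′ → Sp R g g′
  Sp-resp h h′ (nil e e′)        = nil (λ y → ≋-trans (≋-sym (h y)) (e y)) (λ y → ≋-trans (≋-sym (h′ y)) (e′ y))
  Sp-resp h h′ (cons c r s e e′) =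
    cons c r s (λ y → ≋-trans (≋-sym (h y)) (e y)) (λ y → ≋-trans (≋-sym (h′ y)) (e′ y))

  Sp-+ : ∀ {f f′ g g′} → Sp R f f′ → Sp R g g′ → Sp R (λ y → f y + g y) (λ y → f′ y + g′ y)
  Sp-+ {f} {f′} {g} {g′} (nil e e′) t = Sp-resp (zeroed e) (zeroed e′) t
    where zeroed : ∀ {f g} → f ≃ 𝟘 → g ≃ λ y → f y + g y
          zeroed e y = ≋-trans (≋-reflexive (sym (ℤ.+-identityˡ _))) (+-cong (≋-sym (e y)) ≋-refl)
  Sp-+ {g = g} {g′} (cons {x} {x′} {h} {h′} c r s e e′) t =
    cons c r (Sp-+ s t) (assoc x h g e) (assoc x′ h′ g′ e′)
    where assoc : ∀ {f} x h g → f ≃ (λ y → mono c x y + h y) → (λ y → f y + g y) ≃ λ y → mono c x y + (h y + g y)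
          assoc x h g e y = ≋-trans (+-cong (e y) ≋-refl) (≋-reflexive (ℤ.+-assoc (mono c x y) (h y) (g y)))

  Sp-* : ∀ {f f′} k → Sp R f f′ → Sp R (λ y → k * f y) (λ y → k * f′ y)
  Sp-* k (nil e e′) = nil (zeroed e) (zeroed e′)
    where zeroed : ∀ {f} → f ≃ 𝟘 → (λ y → k * f y) ≃ 𝟘
          zeroed e y = ≋-trans (*-congʳ k (e y)) (≋-reflexive (ℤ.*-zeroʳ k))
  Sp-* k (cons {x} {x′} {h} {h′} c r s e e′) = cons (k * c) r (Sp-* k s) (distrib x h e) (distrib x′ h′ e′)
    where distrib : ∀ {f} x h → f ≃ (λ y → mono c x y + h y) → (λ y → k * f y) ≃ λ y → mono (k * c) x y + k * h y
          distrib x h e y = ≋-trans (*-congʳ k (e y)) (≋-reflexive (lemma k c (+ δ p y x) (h y)))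
            where lemma : ∀ k c d h → k * (c * d + h) ≡ k * c * d + k * h
                  lemma = solve-∀

  Sp-flip : ∀ {f f′} → Sp R f f′ → Sp (λ x x′ → R x′ x) f′ f
  Sp-flip (nil e e′)        = nil e′ e
  Sp-flip (cons c r s e e′) = cons c r (Sp-flip s) e′ e

  Sp-mono : ∀ {f f′} → (∀ {x x′} → R x x′ → R′ x x′) → Sp R f f′ → Sp R′ f f′
  Sp-mono h (nil e e′)        = nil e e′
  Sp-mono h (cons c r s e e′) = cons c (h r) (Sp-mono h s) e e′

  Sp-image : ∀ {f f′} → Sp R f f′ → ∀ y → f y ≋[ p ] 0ℤ ⊎ Σ ℕ (R y)
  Sp-image (nil e e′) y = inj₁ (e y)
  Sp-image (cons {x} {x′} c r s e e′) y with y ℕ.≟ x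
  ... | yes refl = inj₂ (x′ , r)
  ... | no y≢x with Sp-image s y
  ...   | inj₂ q = inj₂ q
  ...   | inj₁ z = inj₁ (≋-trans (e y) (≋-trans
            (≋-reflexive (cong (λ d → c * + d + _) (δ-≢ y≢x))) (≋-trans (+-cong (≋-reflexive (ℤ.*-zeroʳ c)) z) ≋-refl)))

  -- `R` is a partial injection, so `y` is the exponent of a given monomial exactly when `y′` is the
  -- matched one.
  Sp-value : PE 3 1 R → ∀ {f f′} → Sp R f f′ → ∀ {y y′} → R y y′ → f y ≋[ p ] f′ y′
  Sp-value pe (nil e e′) r = ≋-trans (e _) (≋-sym (e′ _))
  Sp-value {R} pe (cons {x} {x′} c q s e e′) {y} {y′} r = ≋-trans (e y) (≋-trans
    (+-cong (≋-reflexive (cong (λ d → c * + d) δ≡)) (Sp-value pe s r)) (≋-sym (e′ y′)))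
    where
    δ≡ : δ p y x ≡ δ p y′ x′
    δ≡ with y ℕ.≟ x
    ... | yes refl = trans (δ-refl y) (trans (sym (δ-refl y′)) (cong (δ p y′) (PE-≡ pe r q refl)))
    ... | no y≢x   = trans (δ-≢ y≢x) (sym (δ-≢ (y≢x ∘ PE-≡ (PE-flip pe) r q)))

  Sp-zero : PE 3 1 R → ∀ {f f′} → Sp R f f′ → f ≃ 𝟘 → f′ ≃ 𝟘
  Sp-zero pe s z y with Sp-image (Sp-flip s) y
  ... | inj₁ q       = q
  ... | inj₂ (x , r) = ≋-trans (≋-sym (Sp-value pe s r)) (z x)

  -- The coefficient 1 at `i` does not vanish, so `i` has a partner. Elsewhere `f′` either vanishes
  -- or takes a value of `f` away from `i`.
  Sp-mono-1 : ∀ {R i} → PE 3 1 R → (¬ 1ℤ ≋[ p ] 0ℤ) → ∀ {f f′} → Sp R f f′ → f ≃ mono 1ℤ i →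
              Σ ℕ λ i′ → R i i′ × f′ ≃ mono 1ℤ i′
  Sp-mono-1 {R} {i} pe 1≢0 {f} {f′} s e = go (Sp-image s i)
    where
    at-i : f i ≋[ p ] 1ℤ
    at-i = ≋-trans (e i) (≋-reflexive (cong (λ d → 1ℤ * + d) (δ-refl i)))
    go : f i ≋[ p ] 0ℤ ⊎ Σ ℕ (R i) → Σ ℕ λ i′ → R i i′ × f′ ≃ mono 1ℤ i′
    go (inj₁ z)        = contradiction (≋-trans (≋-sym at-i) z) 1≢0
    go (inj₂ (i′ , r)) = i′ , r , at
      where
      at : f′ ≃ mono 1ℤ i′
      at y with y ℕ.≟ i′
      ... | yes refl = ≋-trans (≋-sym (Sp-value pe s r)) (≋-trans at-i (≋-reflexive (cong (λ d → 1ℤ * + d) (sym (δ-refl y)))))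
      ... | no y≢i′ with Sp-image (Sp-flip s) y
      ...   | inj₁ z       = ≋-trans z (≋-reflexive (cong (λ d → 1ℤ * + d) (sym (δ-≢ y≢i′))))
      ...   | inj₂ (x , q) = ≋-trans (≋-sym (Sp-value pe s q)) (≋-trans (e x)
                (≋-reflexive (cong (λ d → 1ℤ * + d) (trans (δ-≢ λ x≡i → y≢i′ (PE-≡ pe q r x≡i)) (sym (δ-≢ y≢i′))))))


-- The back-and-forth system on tuples of polynomials.

module Game (p : ℕ) .{{p≢0 : NonZero p}} (prime : Prime p) where

  open Span p

  coeff-< : ∀ y (a : Poly p) → coeff p y a ℕ.< p
  coeff-< y       []      = ℕ.>-nonZero⁻¹ p
  coeff-< zero    (x ∷ a) = Fin.toℕ<n x
  coeff-< (suc y) (x ∷ a) = coeff-< y a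

  1<p : 1 ℕ.< p
  1<p = ℕ.nonTrivial⇒n>1 p {{prime⇒nonTrivial prime}}

  1≢0 : ¬ 1ℤ ≋[ p ] 0ℤ
  1≢0 h = contradiction (≋-small 1<p (ℕ.>-nonZero⁻¹ p) h) λ ()

  Finite : F → Set
  Finite f = Σ ℕ λ B → ∀ y → B ℕ.≤ y → f y ≋[ p ] 0ℤ

  finite-⟦⟧ : ∀ a → Finite ⟦ a ⟧
  finite-⟦⟧ a = length a , vanish a
    where vanish : ∀ a y → length a ℕ.≤ y → ⟦ a ⟧ y ≋[ p ] 0ℤ
          vanish []      y       _       = ≋-refl
          vanish (x ∷ a) (suc y) (s≤s h) = vanish a y h

  finite-+ : ∀ {f g} → Finite f → Finite g → Finite (λ y → f y + g y)
  finite-+ (B , h) (C , k) = B ℕ.+ C , λ y le →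
    +-cong (h y (ℕ.≤-trans (ℕ.m≤m+n B C) le)) (k y (ℕ.≤-trans (ℕ.m≤n+m C B) le))

  finite-* : ∀ {f} k → Finite f → Finite (λ y → k * f y)
  finite-* k (B , h) = B , λ y le → ≋-trans (*-congʳ k (h y le)) (≋-reflexive (ℤ.*-zeroʳ k))

  finite-comb : ∀ {n} l (v : Fin n → F) → (∀ i → Finite (v i)) → Finite (comb l v)
  finite-comb {zero}  l v h = 0 , λ y _ → ≋-refl
  finite-comb {suc n} l v h =
    finite-+ (finite-* (l Fin.zero) (h Fin.zero)) (finite-comb (l ∘ Fin.suc) (v ∘ Fin.suc) (h ∘ Fin.suc))

  finite-poly : ∀ {s} (u : Vec (ℤ × ℕ) s) → Finite (poly u)
  finite-poly []            = 0 , λ y _ → ≋-refl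
  finite-poly ((c , x) ∷ u) = finite-+ (finite-* c (suc x , λ y x<y →
    ≋-reflexive (cong +_ (δ-≢ {y} {x} λ { refl → ℕ.<-irrefl refl x<y })))) (finite-poly u)

  realize : ∀ f → Finite f → Σ (Poly p) λ a → ⟦ a ⟧ ≃ f
  realize f (B , h) = go B f , correct B f h
    where
    go : ℕ → F → Poly p
    go zero    f = []
    go (suc B) f = fromℕ< (ℤ.n%ℕd<d (f 0) p) ∷ go B (f ∘ suc)
    correct : ∀ B f → (∀ y → B ℕ.≤ y → f y ≋[ p ] 0ℤ) → ⟦ go B f ⟧ ≃ f
    correct zero    f h y       = ≋-sym (h y z≤n)
    correct (suc B) f h zero    =
      ≋-trans (≋-reflexive (cong +_ (Fin.toℕ-fromℕ< (ℤ.n%ℕd<d (f 0) p)))) (≋-sym (%ℕ-≋ p (f 0)))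
    correct (suc B) f h (suc y) = correct B (f ∘ suc) (λ y → h (suc y) ∘ s≤s) y

  -- Each of the `t` monomials uses up one level of `PEₙ`.
  extend-poly : ∀ {t} n (u : Vec (ℤ × ℕ) t) → PEₙ (t ℕ.+ n) R →
                ¬ ¬ Σ Rel λ R′ → (∀ x x′ → R x x′ → R′ x x′) × PEₙ n R′ ×
                  Σ (Vec (ℤ × ℕ) t) λ u′ → Sp R′ (poly u) (poly u′)
  extend-poly {R} n [] pe = return (R , (λ _ _ r → r) , pe , [] , nil (λ y → ≋-refl) (λ y → ≋-refl))
  extend-poly {R} {suc t} n ((c , x) ∷ u) pe =
    PEₙ-extend (t ℕ.+ n) pe x >>= λ (x′ , pe₁) →
    extend-poly n u pe₁ >>= λ (R′ , sub , pe′ , u′ , sp) →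
    return (R′ , (λ y y′ r → sub y y′ (inj₁ r)) , pe′ , (c , x′) ∷ u′ ,
      cons c (sub x x′ (inj₂ (refl , refl))) sp (λ y → ≋-refl) (λ y → ≋-refl))

  -- The single index `s` bounds both the lengths that are tested and the number of exponents that
  -- can still be added. The two alternatives may overlap, since `Sp` also relates long sums.
  record _~⟨_⟩_ {n} (v : Fin n → F) (s : ℕ) (v′ : Fin n → F) : Set₁ where
    field
      rel-on    : Rel
      presburger : PEₙ s rel-on
      dichotomy : ∀ l → Sp rel-on (comb l v) (comb l v′) ⊎ (¬ Short s (comb l v) × ¬ Short s (comb l v′))
  open _~⟨_⟩_

  ~-flip : ∀ {n s} {v v′ : Fin n → F} → v ~⟨ s ⟩ v′ → v′ ~⟨ s ⟩ v
  ~-flip e .rel-on x x′ = e .rel-on x′ x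
  ~-flip e .presburger = PE-flip (e .presburger)
  ~-flip e .dichotomy l with e .dichotomy l
  ... | inj₁ sp        = inj₁ (Sp-flip sp)
  ... | inj₂ (ns , ns′) = inj₂ (ns′ , ns)

  ~-weaken : ∀ {n} s t {v v′ : Fin n → F} → v ~⟨ s ℕ.+ t ⟩ v′ → v ~⟨ s ⟩ v′
  ~-weaken s t e .rel-on = e .rel-on
  ~-weaken s t e .presburger = PEₙ-drop t {s} (subst (λ k → PEₙ k (e .rel-on)) (ℕ.+-comm s t) (e .presburger))
  ~-weaken s t e .dichotomy l with e .dichotomy l
  ... | inj₁ sp         = inj₁ sp
  ... | inj₂ (ns , ns′) = inj₂ (ns ∘ Short-pad t , ns′ ∘ Short-pad t)

  module _ {n} (v : Fin (suc n) → F) (l : Fin (suc n) → ℤ) where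

    private
      k = l Fin.zero
      l↓ = l ∘ Fin.suc
      v↓ = v ∘ Fin.suc

    -- Subtracting a multiple of a combination that makes the new element short.
    residual : (Fin n → ℤ) → Fin n → ℤ
    residual m i = 1ℤ * l↓ i + (- k) * m i

    comb-residual : ∀ m {s} (u : Vec (ℤ × ℕ) s) → (∀ y → v Fin.zero y + comb m v↓ y ≋[ p ] poly u y) →
                    ∀ y → comb l v y ≋[ p ] k * poly u y + comb (residual m) v↓ y
    comb-residual m u h y = ≋-via k (h y) (trans (lemma k (v Fin.zero y) (comb l↓ v↓ y) (poly u y) (comb m v↓ y))
        (cong (λ c → k * poly u y + c + k * (v Fin.zero y + comb m v↓ y - poly u y)) (sym (comb-linear 1ℤ (- k) l↓ m v↓ y))))
      where lemma : ∀ k w c u d → k * w + c ≡ k * u + (1ℤ * c + (- k) * d) + k * (w + d - u)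
            lemma = solve-∀

    -- If the combination were a sum of `s` monomials, subtracting `k` times `u` would make the
    -- residual a sum of `2 s`.
    residual-long : ∀ m {s} (u : Vec (ℤ × ℕ) s) → (∀ y → v Fin.zero y + comb m v↓ y ≋[ p ] poly u y) →
                    ¬ Short (s ℕ.+ s) (comb (residual m) v↓) → ¬ Short s (comb l v)
    residual-long m u h ns sh = ns (Short-resp
      (λ y → ≋-via 1ℤ (comb-residual m u h y) (lemma k (comb l v y) (poly u y) (comb (residual m) v↓ y)))
      (Short-+ sh (Short-* (- k) (u , λ y → ≋-refl))))
      where lemma : ∀ k a u c → a + (- k) * u ≡ c + 1ℤ * (a - (k * u + c))
            lemma = solve-∀

    comb-zero-head : k ≋[ p ] 0ℤ → ∀ y → comb l v y ≋[ p ] comb l↓ v↓ y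
    comb-zero-head k≋0 y = ≋-via (v Fin.zero y) k≋0 (lemma k (v Fin.zero y) _)
      where lemma : ∀ k w c → k * w + c ≡ c + w * (k - 0ℤ)
            lemma = solve-∀

    -- Modulo the prime `p` the leading coefficient can be divided out, and shortness survives
    -- scaling.
    normalise : ∀ {s} → ¬ k ≋[ p ] 0ℤ → Short s (comb l v) →
                Σ (Fin n → ℤ) λ m → Short s (λ y → v Fin.zero y + comb m v↓ y)
    normalise k≢0 sh with j , jk≋1 ← inverse prime k k≢0 = (λ i → j * l↓ i + 0ℤ * l↓ i) ,
      Short-resp (λ y → ≋-via (v Fin.zero y) jk≋1
        (trans (lemma j k (v Fin.zero y) (comb l↓ v↓ y))
          (cong (λ c → v Fin.zero y + c + v Fin.zero y * (j * k - 1ℤ)) (sym (comb-linear j 0ℤ l↓ l↓ v↓ y)))))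
        (Short-* j sh)
      where lemma : ∀ j k w c → j * (k * w + c) ≡ w + (j * c + 0ℤ * c) + w * (j * k - 1ℤ)
            lemma = solve-∀

  ones : ℕ → F
  ones B y with y ℕ.<? B
  ... | yes _ = 1ℤ
  ... | no _  = 0ℤ

  ones-< : ∀ {B y} → y ℕ.< B → ones B y ≡ 1ℤ
  ones-< {B} {y} y<B with y ℕ.<? B
  ... | yes _   = refl
  ... | no y≮B  = contradiction y<B y≮B

  ones-finite : ∀ B → Finite (ones B)
  ones-finite B = B , λ y B≤y → ≋-reflexive (vanish y B≤y)
    where vanish : ∀ y → B ℕ.≤ y → ones B y ≡ 0ℤ
          vanish y B≤y with y ℕ.<? B
          ... | yes y<B = contradiction y<B (ℕ.≤⇒≯ B≤y)
          ... | no _    = refl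

  common-finite : ∀ {n} (e : Vector (Poly p) n) →
                  Σ ℕ λ B → ∀ l y → B ℕ.≤ y → comb l ⟦ e ⟧* y ≋[ p ] 0ℤ
  common-finite {zero}  e = 0 , λ l y _ → ≋-refl
  common-finite {suc n} e with B , h ← common-finite (e ∘ Fin.suc) | C , k ← finite-⟦⟧ (e Fin.zero) =
    B ℕ.+ C , λ l y le → ≋-trans
      (+-cong (*-congʳ (l Fin.zero) (k y (ℕ.≤-trans (ℕ.m≤n+m C B) le))) (h (l ∘ Fin.suc) y (ℕ.≤-trans (ℕ.m≤m+n B C) le)))
      (≋-reflexive (cong (λ c → c + 0ℤ) (ℤ.*-zeroʳ (l Fin.zero))))

  -- The doubled index serves twice: half of the exponent levels transport `u`, and `residual-long`
  -- needs the dichotomy at length `2 s`.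
  forth : ∀ {n} s {e e′ : Vector (Poly p) n} → ⟦ e ⟧* ~⟨ s ℕ.+ s ⟩ ⟦ e′ ⟧* → ∀ a →
          ¬ ¬ Σ (Poly p) λ a′ → ⟦ a Vector.∷ e ⟧* ~⟨ s ⟩ ⟦ a′ Vector.∷ e′ ⟧*
  forth {n} s {e} {e′} E a = lem (Σ (Fin n → ℤ) λ m → Short s (λ y → ⟦ a ⟧ y + comb m ⟦ e ⟧* y)) >>= λ
    { (yes (m , u , h)) →
        extend-poly s u (E .presburger) >>= λ (R′ , sub , pe′ , u′ , sp) → return (near m u h R′ sub pe′ u′ sp)
    ; (no none) → return (far none) }
    where
    near : ∀ m (u : Vec (ℤ × ℕ) s) (h : ∀ y → ⟦ a ⟧ y + comb m ⟦ e ⟧* y ≋[ p ] poly u y) →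
           ∀ R′ → (∀ x x′ → E .rel-on x x′ → R′ x x′) → PEₙ s R′ → (u′ : Vec (ℤ × ℕ) s) → Sp R′ (poly u) (poly u′) →
           Σ (Poly p) λ a′ → ⟦ a Vector.∷ e ⟧* ~⟨ s ⟩ ⟦ a′ Vector.∷ e′ ⟧*
    near m u h R′ sub pe′ u′ sp = a′ , record { rel-on = R′ ; presburger = pe′ ; dichotomy = dich }
      where
      -- The answer solves for `a′` the equation of `a`, with `u′` in place of `u` and `e′` in place
      -- of `e`.
      r = realize (λ y → poly u′ y + - 1ℤ * comb m ⟦ e′ ⟧* y)
            (finite-+ (finite-poly u′) (finite-* (- 1ℤ) (finite-comb m ⟦ e′ ⟧* (finite-⟦⟧ ∘ e′))))
      a′ = proj₁ r
      h′ : ∀ y → ⟦ a′ ⟧ y + comb m ⟦ e′ ⟧* y ≋[ p ] poly u′ y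
      h′ y = ≋-via 1ℤ (proj₂ r y) (lemma (⟦ a′ ⟧ y) (comb m ⟦ e′ ⟧* y) (poly u′ y))
        where lemma : ∀ a c u → a + c ≡ u + 1ℤ * (a - (u + - 1ℤ * c))
              lemma = solve-∀
      v  = ⟦ a Vector.∷ e ⟧*
      v′ = ⟦ a′ Vector.∷ e′ ⟧*
      dich : ∀ l → Sp R′ (comb l v) (comb l v′) ⊎ (¬ Short s (comb l v) × ¬ Short s (comb l v′))
      dich l with E .dichotomy (residual v l m)
      ... | inj₁ t = inj₁ (Sp-resp (λ y → ≋-sym (comb-residual v l m u h y)) (λ y → ≋-sym (comb-residual v′ l m u′ h′ y))
                       (Sp-+ (Sp-* (l Fin.zero) sp) (Sp-mono (sub _ _) t)))
      ... | inj₂ (ns , ns′) = inj₂ (residual-long v l m u h ns , residual-long v′ l m u′ h′ ns′)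

    far : ¬ (Σ (Fin n → ℤ) λ m → Short s (λ y → ⟦ a ⟧ y + comb m ⟦ e ⟧* y)) →
          Σ (Poly p) λ a′ → ⟦ a Vector.∷ e ⟧* ~⟨ s ⟩ ⟦ a′ Vector.∷ e′ ⟧*
    far none = a′ , record { rel-on = E↓ .rel-on ; presburger = E↓ .presburger ; dichotomy = dich }
      where
      E↓ = ~-weaken s s E
      B = proj₁ (common-finite e′)
      -- The ones extend `s + 1` places beyond the supports in `e′`; there each combination equals
      -- its leading coefficient.
      r = realize (ones (B ℕ.+ suc s)) (ones-finite (B ℕ.+ suc s))
      a′ = proj₁ r
      v  = ⟦ a Vector.∷ e ⟧*
      v′ = ⟦ a′ Vector.∷ e′ ⟧*
      long′ : ∀ l → ¬ l Fin.zero ≋[ p ] 0ℤ → ¬ Short s (comb l v′)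
      long′ l k≢0 = ¬Short B λ j j≤s z → k≢0 (≋-trans (≋-sym (at l j j≤s)) z)
        where
        at : ∀ l j → j ℕ.≤ s → comb l v′ (B ℕ.+ j) ≋[ p ] l Fin.zero
        at l j j≤s = ≋-trans
          (+-cong (*-congʳ (l Fin.zero) (≋-trans (proj₂ r (B ℕ.+ j)) (≋-reflexive (ones-< (ℕ.+-monoʳ-< B (s≤s j≤s))))))
                  (proj₂ (common-finite e′) (l ∘ Fin.suc) (B ℕ.+ j) (ℕ.m≤m+n B j)))
          (≋-reflexive (trans (ℤ.+-identityʳ _) (ℤ.*-identityʳ (l Fin.zero))))
      dich : ∀ l → Sp (E↓ .rel-on) (comb l v) (comb l v′) ⊎ (¬ Short s (comb l v) × ¬ Short s (comb l v′))
      -- A leading coefficient that is nonzero modulo `p` makes both sides long; a zero one leaves a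
      -- combination of the old elements.
      dich l with l Fin.zero ℤ.%ℕ p in eq
      ... | suc k = inj₂ ((λ sh → none (normalise v l k≢0 sh)) , long′ l k≢0)
        where k≢0 : ¬ l Fin.zero ≋[ p ] 0ℤ
              k≢0 z = contradiction (trans (sym eq) (≋-small (ℤ.n%ℕd<d (l Fin.zero) p) (ℕ.>-nonZero⁻¹ p)
                        (≋-trans (≋-sym (%ℕ-≋ p (l Fin.zero))) z))) λ ()
      ... | zero with E↓ .dichotomy (l ∘ Fin.suc)
      ...   | inj₁ t = inj₁ (Sp-resp (λ y → ≋-sym (comb-zero-head v l k≋0 y)) (λ y → ≋-sym (comb-zero-head v′ l k≋0 y)) t)
        where k≋0 : l Fin.zero ≋[ p ] 0ℤ
              k≋0 = subst (λ m → l Fin.zero ≋[ p ] + m) eq (%ℕ-≋ p (l Fin.zero))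
      ...   | inj₂ (ns , ns′) = inj₂ (ns ∘ Short-resp (comb-zero-head v l k≋0) , ns′ ∘ Short-resp (comb-zero-head v′ l k≋0))
        where k≋0 : l Fin.zero ≋[ p ] 0ℤ
              k≋0 = subst (λ m → l Fin.zero ≋[ p ] + m) eq (%ℕ-≋ p (l Fin.zero))

  -- Terms, atomic formulas and the transfer of truth.

  ⊕-+ : ∀ a b y → ⟦ _⊕_ p a b ⟧ y ≋[ p ] ⟦ a ⟧ y + ⟦ b ⟧ y
  ⊕-+ []      b       y       = ≋-reflexive (sym (ℤ.+-identityˡ _))
  ⊕-+ (x ∷ a) []      y       = ≋-reflexive (sym (ℤ.+-identityʳ _))
  ⊕-+ (x ∷ a) (z ∷ b) zero    = ≋-trans
    (≋-reflexive (cong +_ (Fin.toℕ-fromℕ< (ℕ.m%n<n (toℕ x ℕ.+ toℕ z) p))))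
    (≋-trans (≋-sym (%-≋ (toℕ x ℕ.+ toℕ z))) (≋-reflexive (ℤ.pos-+ (toℕ x) (toℕ z))))
  ⊕-+ (x ∷ a) (z ∷ b) (suc y) = ⊕-+ a b y

  -- The factors `1ℤ` produce the shape of `comb-linear`.
  coefficients : ∀ {n} → Term p n → Fin n → ℤ
  coefficients (var i) = unit i
  coefficients (s ⊞ t) i = 1ℤ * coefficients s i + 1ℤ * coefficients t i

  eval-comb : ∀ {n} (t : Term p n) e → ⟦ eval p t e ⟧ ≃ comb (coefficients t) ⟦ e ⟧*
  eval-comb (var i) e y = ≋-reflexive (sym (comb-unit i ⟦ e ⟧* y))
  eval-comb (s ⊞ t) e y = ≋-trans (⊕-+ (eval p s e) (eval p t e) y) (≋-trans
    (+-cong (eval-comb s e y) (eval-comb t e y))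
    (≋-reflexive (sym (trans (comb-linear 1ℤ 1ℤ (coefficients s) (coefficients t) ⟦ e ⟧* y)
      (cong₂ _+_ (ℤ.*-identityˡ (comb (coefficients s) ⟦ e ⟧* y)) (ℤ.*-identityˡ (comb (coefficients t) ⟦ e ⟧* y)))))))

  difference : ∀ {n} (s t : Term p n) → Fin n → ℤ
  difference s t i = 1ℤ * coefficients s i + - 1ℤ * coefficients t i

  eval-difference : ∀ {n} (s t : Term p n) e y →
                    comb (difference s t) ⟦ e ⟧* y ≋[ p ] ⟦ eval p s e ⟧ y - ⟦ eval p t e ⟧ y
  eval-difference s t e y = ≋-trans (≋-reflexive (trans
    (comb-linear 1ℤ (- 1ℤ) (coefficients s) (coefficients t) ⟦ e ⟧* y)
    (lemma (comb (coefficients s) ⟦ e ⟧* y) (comb (coefficients t) ⟦ e ⟧* y))))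
    (+-cong (≋-sym (eval-comb s e y)) (neg-cong (≋-sym (eval-comb t e y))))
    where lemma : ∀ a b → 1ℤ * a + - 1ℤ * b ≡ a - b
          lemma = solve-∀

  Short-≤ : ∀ {s t f} → s ℕ.≤ t → Short s f → Short t f
  Short-≤ {s} {t} {f} s≤t h = subst (λ k → Short k f) (ℕ.m+[n∸m]≡n s≤t) (Short-pad (t ℕ.∸ s) h)

  δ<p : ∀ i j → δ p i j ℕ.< p
  δ<p zero    zero    = 1<p
  δ<p zero    (suc j) = ℕ.>-nonZero⁻¹ p
  δ<p (suc i) zero    = ℕ.>-nonZero⁻¹ p
  δ<p (suc i) (suc j) = δ<p i j

  IsPow⇒mono : ∀ {i a} → IsPow p i a → ⟦ a ⟧ ≃ mono 1ℤ i
  IsPow⇒mono {i} h y = ≋-reflexive (trans (cong +_ (h y)) (sym (ℤ.*-identityˡ (+ δ p y i))))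

  mono⇒IsPow : ∀ {i a} → ⟦ a ⟧ ≃ mono 1ℤ i → IsPow p i a
  mono⇒IsPow {i} {a} h y = ≋-small (coeff-< y a) (δ<p y i)
    (≋-trans (h y) (≋-reflexive (ℤ.*-identityˡ (+ δ p y i))))

  module Atomic {n s} (s≥1 : 1 ℕ.≤ s) {e e′ : Vector (Poly p) n} (E : ⟦ e ⟧* ~⟨ s ⟩ ⟦ e′ ⟧*) where

    private
      pe : PE 3 1 (E .rel-on)
      pe = PEₙ-base s (E .presburger)

    -- Atomic formulas concern combinations that are zero or a monomial. At index at least 1 these
    -- are never long, so they are matched.
    short-Sp : ∀ l → Short 1 (comb l ⟦ e ⟧*) → Sp (E .rel-on) (comb l ⟦ e ⟧*) (comb l ⟦ e′ ⟧*)
    short-Sp l sh with E .dichotomy l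
    ... | inj₁ sp       = sp
    ... | inj₂ (ns , _) = contradiction (Short-≤ s≥1 sh) ns

    -- The difference of the terms vanishes on one side, hence on the other; coefficients below `p`
    -- turn congruence back into equality.
    transfer-≈ : ∀ t u → _≈_ p (eval p t e) (eval p u e) → _≈_ p (eval p t e′) (eval p u e′)
    transfer-≈ t u h y = ≋-small (coeff-< y (eval p t e′)) (coeff-< y (eval p u e′))
      (≋-via 1ℤ (≋-trans (≋-sym (eval-difference t u e′ y)) (Sp-zero pe (short-Sp (difference t u) short) zero-e y)) (lemma (⟦ eval p t e′ ⟧ y) (⟦ eval p u e′ ⟧ y)))
      where
      zero-e : comb (difference t u) ⟦ e ⟧* ≃ 𝟘
      zero-e y = ≋-trans (eval-difference t u e y)
        (≋-reflexive (trans (cong (λ c → + c - ⟦ eval p u e ⟧ y) (h y)) (ℤ.+-inverseʳ (⟦ eval p u e ⟧ y))))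
      short : Short 1 (comb (difference t u) ⟦ e ⟧*)
      short = Short-resp (λ y → ≋-sym (zero-e y)) (Short-𝟘 1)
      lemma : ∀ a b → a ≡ b + 1ℤ * (a - b - 0ℤ)
      lemma = solve-∀

    transfer-pow : ∀ t {i} → IsPow p i (eval p t e) → Σ ℕ λ i′ → E .rel-on i i′ × IsPow p i′ (eval p t e′)
    transfer-pow t {i} h =
      let i′ , r , h′ = Sp-mono-1 pe 1≢0 (short-Sp (coefficients t) short) mono-e in
      i′ , r , mono⇒IsPow {a = eval p t e′} (λ y → ≋-trans (eval-comb t e′ y) (h′ y))
      where
      mono-e : comb (coefficients t) ⟦ e ⟧* ≃ mono 1ℤ i
      mono-e y = ≋-trans (≋-sym (eval-comb t e y)) (IsPow⇒mono {a = eval p t e} h y)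
      short : Short 1 (comb (coefficients t) ⟦ e ⟧*)
      short = (1ℤ , i) ∷ [] , λ y → ≋-trans (mono-e y) (≋-reflexive (sym (ℤ.+-identityʳ _)))

    transfer-M : ∀ t u w → M p (eval p t e) (eval p u e) (eval p w e) → M p (eval p t e′) (eval p u e′) (eval p w e′)
    transfer-M t u w (i , j , hi , hj , hk)
      with i′ , ri , hi′ ← transfer-pow t hi | j′ , rj , hj′ ← transfer-pow u hj | k′ , rk , hk′ ← transfer-pow w hk =
      i′ , j′ , hi′ , hj′ , subst (λ k → IsPow p k (eval p w e′)) (sym (PE-+ pe ri rj rk refl)) hk′

  depth : ∀ {n} → Formula p n → ℕ
  depth (_ ≐ _)     = 0
  depth (rel _ _ _) = 0
  depth (~ φ)       = depth φ
  depth (φ ∧ ψ)     = depth φ ℕ.⊔ depth ψ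
  depth (∃' φ)      = suc (depth φ)

  -- This is `2 ^ r`, because `forth` halves the index at each quantifier.
  threshold : ℕ → ℕ
  threshold zero    = 1
  threshold (suc r) = threshold r ℕ.+ threshold r

  threshold≥1 : ∀ r → 1 ℕ.≤ threshold r
  threshold≥1 zero    = ℕ.≤-refl
  threshold≥1 (suc r) = ℕ.≤-trans (threshold≥1 r) (ℕ.m≤m+n (threshold r) (threshold r))

  -- One implication is enough for the induction: negation reverses it by `~-flip`. The double
  -- negation from `forth` is absorbed by the meaning of `∃'`.
  transfer : ∀ {n} (φ : Formula p n) r → depth φ ℕ.≤ r → {e e′ : Vector (Poly p) n} →
             ⟦ e ⟧* ~⟨ threshold r ⟩ ⟦ e′ ⟧* → Sat p φ e → Sat p φ e′
  transfer (t ≐ u)     r le E h = Atomic.transfer-≈ (threshold≥1 r) E t u h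
  transfer (rel t u w) r le E h = Atomic.transfer-M (threshold≥1 r) E t u w h
  transfer (~ φ)       r le E h = h ∘ transfer φ r le (~-flip E)
  transfer (φ ∧ ψ)     r le E (h , k) =
    transfer φ r (ℕ.m⊔n≤o⇒m≤o _ _ le) E h , transfer ψ r (ℕ.m⊔n≤o⇒n≤o _ _ le) E k
  transfer (∃' φ) (suc r) (s≤s le) E h =
    h >>= λ (a , sat) → forth (threshold r) E a >>= λ (a′ , E′) → return (a′ , transfer φ r le E′ sat)


-- Counting classes

-- A colouring whose colour classes consist of related elements: an upper bound `K` on the number of
-- classes.
Codes : {T : Set} → (T → T → Set) → ℕ → Set
Codes {T} _∼_ K = Σ (T → Fin K) λ c → ∀ t t′ → c t ≡ c t′ → t ∼ t′

codes-≡ : ∀ {T K} (f : T → Fin K) → Codes (λ t t′ → f t ≡ f t′) K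
codes-≡ f = f , λ _ _ eq → eq

codes-map : ∀ {T K} {P Q : T → T → Set} → (∀ t t′ → P t t′ → Q t t′) → Codes P K → Codes Q K
codes-map f (c , h) = c , λ t t′ eq → f t t′ (h t t′ eq)

codes-× : ∀ {T K L} {P Q : T → T → Set} → Codes P K → Codes Q L → Codes (λ t t′ → P t t′ × Q t t′) (K ℕ.* L)
codes-× (c , h) (d , k) = (λ t → Fin.combine (c t) (d t)) , λ t t′ eq →
  let eq₁ , eq₂ = Fin.combine-injective (c t) (d t) (c t′) (d t′) eq in h t t′ eq₁ , k t t′ eq₂

funToFin-injective : ∀ {m n} (f g : Fin m → Fin n) → Fin.funToFin f ≡ Fin.funToFin g → ∀ i → f i ≡ g i
funToFin-injective f g eq i =
  trans (sym (Fin.finToFun-funToFin f i)) (trans (cong (λ x → Fin.finToFun x i) eq) (Fin.finToFun-funToFin g i))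

codes-Π : ∀ {T K n} {P : Fin n → T → T → Set} → (∀ i → Codes (P i) K) → Codes (λ t t′ → ∀ i → P i t t′) (K ℕ.^ n)
codes-Π h = (λ t → Fin.funToFin (λ i → proj₁ (h i) t)) ,
  λ t t′ eq i → proj₂ (h i) t t′ (funToFin-injective _ _ eq i)

codes-∈ : ∀ {T X : Set} {K} {P : X → T → T → Set} (xs : List X) → (∀ x → Codes (P x) K) →
          Codes (λ t t′ → ∀ x → x ∈ xs → P x t t′) (K ℕ.^ length xs)
codes-∈ {P = P} xs h = codes-map
  (λ t t′ f x x∈ → subst (λ x → P x t t′) (sym (Any.lookup-index x∈)) (f (index x∈)))
  (codes-Π (λ i → h (List.lookup xs i)))

count : List ℤ → ℤ → ℕ
count []       z = 0
count (g ∷ gs) z with g ℤ.≤? z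
... | yes _ = suc (count gs z)
... | no _  = count gs z

count-≤-length : ∀ gs z → count gs z ℕ.≤ length gs
count-≤-length []       z = z≤n
count-≤-length (g ∷ gs) z with g ℤ.≤? z
... | yes _ = s≤s (count-≤-length gs z)
... | no _  = ℕ.m≤n⇒m≤1+n (count-≤-length gs z)

count-mono : ∀ gs {z z′} → z ≤ z′ → count gs z ℕ.≤ count gs z′
count-mono []       z≤z′ = z≤n
count-mono (g ∷ gs) {z} {z′} z≤z′ with g ℤ.≤? z | g ℤ.≤? z′
... | yes _   | yes _    = s≤s (count-mono gs z≤z′)
... | yes g≤z | no g≰z′  = contradiction (ℤ.≤-trans g≤z z≤z′) g≰z′
... | no _    | yes _    = ℕ.m≤n⇒m≤1+n (count-mono gs z≤z′)
... | no _    | no _     = count-mono gs z≤z′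

-- The entries below `z` are among those below `z′`, so equal numbers force equal sets.
count-cut : ∀ gs {z z′} → z ≤ z′ → count gs z ≡ count gs z′ → ∀ {g} → g ∈ gs → (g ≤ z) ⇔ (g ≤ z′)
count-cut (g ∷ gs) {z} {z′} z≤z′ eq x∈ with g ℤ.≤? z | g ℤ.≤? z′
count-cut (g ∷ gs) z≤z′ eq (here refl) | yes p | yes q = mk⇔ (λ _ → q) (λ _ → p)
count-cut (g ∷ gs) z≤z′ eq (there x∈)  | yes _ | yes _ = count-cut gs z≤z′ (ℕ.suc-injective eq) x∈
count-cut (g ∷ gs) z≤z′ eq x∈          | yes p | no ¬q = contradiction (ℤ.≤-trans p z≤z′) ¬q
count-cut (g ∷ gs) z≤z′ eq x∈          | no _  | yes _ =
  contradiction (count-mono gs z≤z′) (ℕ.<⇒≱ (ℕ.≤-reflexive (sym eq)))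
count-cut (g ∷ gs) z≤z′ eq (here refl) | no ¬p | no ¬q = mk⇔ (λ p → contradiction p ¬p) (λ q → contradiction q ¬q)
count-cut (g ∷ gs) z≤z′ eq (there x∈)  | no _  | no _  = count-cut gs z≤z′ eq x∈

-- The linear order leaves one more cut than there are entries, against exponentially many sets of
-- entries. The polynomial count rests on this.
codes-cut : ∀ {T : Set} (gs : List ℤ) (h : T → ℤ) →
            Codes (λ t t′ → ∀ g → g ∈ gs → (g ≤ h t) ⇔ (g ≤ h t′)) (suc (length gs))
codes-cut gs h = codes-map cut (codes-≡ code)
  where
  code = λ t → fromℕ< (s≤s (count-≤-length gs (h t)))
  cut : ∀ t t′ → code t ≡ code t′ → ∀ g → g ∈ gs → (g ≤ h t) ⇔ (g ≤ h t′)
  cut t t′ eq g x∈ with eq′ ← Fin.fromℕ<-injective (count gs (h t)) (count gs (h t′)) (s≤s (count-≤-length gs (h t))) (s≤s (count-≤-length gs (h t′))) eq with ℤ.≤-total (h t) (h t′)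
  ... | inj₁ le = count-cut gs le eq′ x∈
  ... | inj₂ le = ⇔-sym (count-cut gs le (sym eq′) x∈)

-- Counting the types of exponents over fixed parameters.

module Sums {X : Set} (_∙_ : X → X → X) (ε : X) where

  sums : List X → ℕ → List X
  sums xs zero    = ε ∷ []
  sums xs (suc c) = cartesianProductWith _∙_ xs (sums xs c)

  sums-∷ : ∀ {xs} c x y → x ∈ xs → y ∈ sums xs c → (x ∙ y) ∈ sums xs (suc c)
  sums-∷ c x y = ∈.∈-cartesianProductWith⁺ _∙_ {a = x} {y}

length-cartesianProductWith : ∀ {X Y Z : Set} (f : X → Y → Z) xs ys →
                              length (cartesianProductWith f xs ys) ≡ length xs ℕ.* length ys
length-cartesianProductWith f []       ys = refl
length-cartesianProductWith f (x ∷ xs) ys = trans (List.length-++ (List.map (f x) ys))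
  (cong₂ ℕ._+_ (List.length-map (f x) ys) (length-cartesianProductWith f xs ys))

gather : ∀ {X : Set} {n} → (Fin n → List X) → List X
gather f = List.concat (List.tabulate f)

∈-gather : ∀ {X : Set} {n} (f : Fin n → List X) i {x} → x ∈ f i → x ∈ gather f
∈-gather f i x∈ = ∈.∈-concat⁺′ x∈ (∈.∈-tabulate⁺ i)

length-gather : ∀ {X : Set} {n} c (f : Fin n → List X) → (∀ i → length (f i) ≡ c) → length (gather f) ≡ n ℕ.* c
length-gather {n = zero}  c f h = refl
length-gather {n = suc n} c f h = trans (List.length-++ (f Fin.zero))
  (cong₂ ℕ._+_ (h Fin.zero) (length-gather c (f ∘ Fin.suc) (h ∘ Fin.suc)))

length-sums : ∀ {X : Set} (_∙_ : X → X → X) ε xs c → length (Sums.sums _∙_ ε xs c) ≡ length xs ℕ.^ c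
length-sums _∙_ ε xs zero    = refl
length-sums _∙_ ε xs (suc c) = trans (length-cartesianProductWith _∙_ xs _) (cong (length xs ℕ.*_) (length-sums _∙_ ε xs c))

-- One cut among at most `(1 + 2 ∣A∣) ^ C` fixed values for each of `(1 + 2 ∣Z∣) ^ C` varying forms,
-- then the residues of the `∣Z∣` varying exponents. With the other arguments fixed this is
-- polynomial in `∣A∣`.
types : ℕ → ℕ → ℕ → ℕ → ℕ
types C D ∣A∣ ∣Z∣ = suc ((1 ℕ.+ (∣A∣ ℕ.+ ∣A∣)) ℕ.^ C) ℕ.^ ((1 ℕ.+ (∣Z∣ ℕ.+ ∣Z∣)) ℕ.^ C) ℕ.* D ℕ.^ ∣Z∣

module Forms {T : Set} (A : List ℕ) (Z : List (T → ℕ)) where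

  -- Parameter exponents are matched with themselves, and those of `t` with the ones in the same
  -- place for `t′`.
  Match : T → T → Rel
  Match t t′ x x′ = (x ∈ A × x ≡ x′) ⊎ Σ (T → ℕ) λ h → h ∈ Z × x ≡ h t × x′ ≡ h t′

  private
    _⊕′_ : (T → ℤ) → (T → ℤ) → T → ℤ
    (f ⊕′ g) t = f t + g t

    -- Zero is an entry so that sums of exactly `c` entries include all shorter ones.
    pm : List ℤ
    pm = 0ℤ ∷ List.map +_ A List.++ List.map (λ x → - + x) A

    pmᶻ : List (T → ℤ)
    pmᶻ = (λ _ → 0ℤ) ∷ List.map (λ h t → + h t) Z List.++ List.map (λ h t → - + h t) Z

    αs : ℕ → List ℤ
    αs = Sums.sums _+_ 0ℤ pm

    κs : ℕ → List (T → ℤ)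
    κs = Sums.sums _⊕′_ (λ _ → 0ℤ) pmᶻ

    pos∈ : ∀ {x} → x ∈ A → + x ∈ pm
    pos∈ x∈ = there (∈.∈-++⁺ˡ (∈.∈-map⁺ +_ x∈))
    neg∈ : ∀ {x} → x ∈ A → - + x ∈ pm
    neg∈ x∈ = there (∈.∈-++⁺ʳ (List.map +_ A) (∈.∈-map⁺ (λ x → - + x) x∈))
    posᶻ∈ : ∀ {h} → h ∈ Z → (λ t → + h t) ∈ pmᶻ
    posᶻ∈ h∈ = there (∈.∈-++⁺ˡ (∈.∈-map⁺ (λ h t → + h t) h∈))
    negᶻ∈ : ∀ {h} → h ∈ Z → (λ t → - + h t) ∈ pmᶻ
    negᶻ∈ h∈ = there (∈.∈-++⁺ʳ (List.map (λ h t → + h t) Z) (∈.∈-map⁺ (λ h t → - + h t) h∈))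

    record Split (c : ℕ) (t t′ : T) (z z′ : ℤ) : Set where
      constructor splits
      field
        α       : ℤ
        κ       : T → ℤ
        α∈      : α ∈ αs c
        κ∈      : κ ∈ κs c
        eq      : z ≡ α + κ t
        eq′     : z′ ≡ α + κ t′

    0∈ : 0ℤ ∈ pm
    0∈ = here refl
    0ᶻ∈ : (λ _ → 0ℤ) ∈ pmᶻ
    0ᶻ∈ = here refl

    extendᵃ : ∀ {c t t′ z z′} a → a ∈ pm → Split c t t′ z z′ → Split (suc c) t t′ (a + z) (a + z′)
    extendᵃ {c} {t} {t′} a a∈ (splits α κ α∈ κ∈ refl refl) = splits (a + α) (λ t → 0ℤ + κ t)
      (Sums.sums-∷ _+_ 0ℤ c a α a∈ α∈) (Sums.sums-∷ _⊕′_ (λ _ → 0ℤ) c (λ _ → 0ℤ) κ 0ᶻ∈ κ∈)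
      (lemma a α (κ t)) (lemma a α (κ t′))
      where lemma : ∀ a α k → a + (α + k) ≡ a + α + (0ℤ + k)
            lemma = solve-∀

    extendᶻ : ∀ {c t t′ z z′} f → f ∈ pmᶻ → Split c t t′ z z′ → Split (suc c) t t′ (f t + z) (f t′ + z′)
    extendᶻ {c} {t} {t′} f f∈ (splits α κ α∈ κ∈ refl refl) = splits (0ℤ + α) (λ t → f t + κ t)
      (Sums.sums-∷ _+_ 0ℤ c 0ℤ α 0∈ α∈) (Sums.sums-∷ _⊕′_ (λ _ → 0ℤ) c f κ f∈ κ∈)
      (lemma (f t) α (κ t)) (lemma (f t′) α (κ t′))
      where lemma : ∀ f α k → f + (α + k) ≡ 0ℤ + α + (f + k)
            lemma = solve-∀

    -- The fixed part `α` and the varying part `κ` are common to both sides. Each summand goes to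
    -- one part while zero is added to the other.
    split : ∀ {t t′ c z z′} → Lin (Match t t′) c z z′ → Split c t t′ z z′
    split nil = splits 0ℤ (λ _ → 0ℤ) (here refl) (here refl) refl refl
    split (skip {z = z} {z′} l) with splits α κ α∈ κ∈ e e′ ← extendᵃ 0ℤ 0∈ (split l) =
      splits α κ α∈ κ∈ (trans (sym (ℤ.+-identityˡ z)) e) (trans (sym (ℤ.+-identityˡ z′)) e′)
    split (pos {x = x} (inj₁ (x∈ , refl)) l)    = extendᵃ (+ x) (pos∈ x∈) (split l)
    split (neg {x = x} (inj₁ (x∈ , refl)) l)    = extendᵃ (- + x) (neg∈ x∈) (split l)
    split (pos (inj₂ (h , h∈ , refl , refl)) l) = extendᶻ (λ t → + h t) (posᶻ∈ h∈) (split l)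
    split (neg (inj₂ (h , h∈ , refl , refl)) l) = extendᶻ (λ t → - + h t) (negᶻ∈ h∈) (split l)

    shift : ∀ α k → (0ℤ ≤ α + k) ⇔ (- α ≤ k)
    shift α k = mk⇔
      (λ h → ℤ.0≤i-j⇒j≤i (subst (0ℤ ≤_) (lemma α k) h))
      (λ h → subst (0ℤ ≤_) (sym (lemma α k)) (ℤ.i≤j⇒0≤j-i h))
      where lemma : ∀ α k → α + k ≡ k - - α
            lemma = solve-∀

  -- The sign of `α + κ t` is the position of `κ t` relative to `- α`, so cuts and residues
  -- determine the type.
  codes-PE : ∀ C D .{{_ : NonZero D}} → 1 ∈ A → Codes (λ t t′ → PE C D (Match t t′)) (types C D (length A) (length Z))
  codes-PE C D 1∈A = subst (Codes _) size (codes-map build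
    (codes-× (codes-∈ (κs C) (λ κ → codes-cut (List.map -_ (αs C)) κ))
             (codes-∈ Z (λ h → codes-≡ (λ t → fromℕ< (ℕ.m%n<n (h t) D))))))
    where
    length-pm : ∀ {X Y : Set} (f g : X → Y) (e : Y) xs →
                length (e ∷ List.map f xs List.++ List.map g xs) ≡ 1 ℕ.+ (length xs ℕ.+ length xs)
    length-pm f g e xs = cong suc (trans (List.length-++ (List.map f xs))
      (cong₂ ℕ._+_ (List.length-map f xs) (List.length-map g xs)))

    size : suc (length (List.map -_ (αs C))) ℕ.^ length (κs C) ℕ.* D ℕ.^ length Z ≡ types C D (length A) (length Z)
    size = cong₂ (λ a b → suc a ℕ.^ b ℕ.* D ℕ.^ length Z)
      (trans (List.length-map -_ (αs C)) (trans (length-sums _+_ 0ℤ pm C) (cong (ℕ._^ C) (length-pm +_ (λ x → - + x) 0ℤ A))))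
      (trans (length-sums _⊕′_ (λ _ → 0ℤ) pmᶻ C) (cong (ℕ._^ C) (length-pm (λ h (t : T) → + h t) (λ h t → - + h t) (λ _ → 0ℤ) Z)))

    build : ∀ t t′ →
            (∀ κ → κ ∈ κs C → ∀ g → g ∈ List.map -_ (αs C) → (g ≤ κ t) ⇔ (g ≤ κ t′)) ×
            (∀ h → h ∈ Z → fromℕ< (ℕ.m%n<n (h t) D) ≡ fromℕ< (ℕ.m%n<n (h t′) D)) →
            PE C D (Match t t′)
    build t t′ (cuts , residues) = record { one = inj₁ (1∈A , refl) ; sign = signs ; res = residue }
      where
      signs : ∀ {z z′} → Lin (Match t t′) C z z′ → (0ℤ ≤ z) ⇔ (0ℤ ≤ z′)
      signs l with splits α κ α∈ κ∈ refl refl ← split l =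
        ⇔-sym (shift α (κ t′)) ⇔-∘ (cuts κ κ∈ _ (∈.∈-map⁺ -_ α∈) ⇔-∘ shift α (κ t))
      residue : ∀ {x x′} → Match t t′ x x′ → + x ≋[ D ] + x′
      residue (inj₁ (_ , refl)) = ≋-refl
      residue (inj₂ (h , h∈ , refl , refl)) = ≋-trans (%-≋ (h t)) (≋-trans
        (≋-reflexive (cong +_ (Fin.fromℕ<-injective (h t ℕ.% D) (h t′ ℕ.% D) (ℕ.m%n<n (h t) D) (ℕ.m%n<n (h t′) D) (residues h h∈)))) (≋-sym (%-≋ (h t′))))


-- Finite choice under double negation, and polynomial growth.

¬¬-choice : ∀ {n} {P : Fin n → Set} → (∀ i → ¬ ¬ P i) → ¬ ¬ (∀ i → P i)
¬¬-choice {zero}  h = return λ ()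
¬¬-choice {suc n} h = h Fin.zero >>= λ p₀ → ¬¬-choice (h ∘ Fin.suc) >>= λ ps →
  return λ { Fin.zero → p₀ ; (Fin.suc i) → ps i }

-- Only powers of two are tested, so products and powers act on the exponent d alone.
record PolyBounded (f : ℕ → ℕ) : Set where
  constructor _,_
  field
    degree  : ℕ
    bounded : ∀ u → f (2 ℕ.^ u) ℕ.≤ 2 ℕ.^ (suc u ℕ.* degree)

n<2^n : ∀ n → n ℕ.< 2 ℕ.^ n
n<2^n zero    = s≤s z≤n
n<2^n (suc n) = ℕ.+-mono-≤-< (ℕ.m^n>0 2 n) (subst (n ℕ.<_) (sym (ℕ.+-identityʳ _)) (n<2^n n))

PolyBounded-const : ∀ c → PolyBounded (λ _ → c)
PolyBounded-const c = c , λ u → ℕ.≤-trans (ℕ.<⇒≤ (n<2^n c)) (ℕ.^-monoʳ-≤ 2 (ℕ.m≤n*m c (suc u)))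

PolyBounded-id : PolyBounded (λ n → n)
PolyBounded-id = 1 , λ u → ℕ.^-monoʳ-≤ 2 (ℕ.≤-trans (ℕ.n≤1+n u) (ℕ.≤-reflexive (sym (ℕ.*-identityʳ (suc u)))))

PolyBounded-* : ∀ {f g} → PolyBounded f → PolyBounded g → PolyBounded (λ n → f n ℕ.* g n)
PolyBounded-* {f} {g} (d , h) (e , k) = d ℕ.+ e , λ u → subst (f (2 ℕ.^ u) ℕ.* g (2 ℕ.^ u) ℕ.≤_)
  (trans (sym (ℕ.^-distribˡ-+-* 2 (suc u ℕ.* d) (suc u ℕ.* e))) (cong (2 ℕ.^_) (sym (ℕ.*-distribˡ-+ (suc u) d e))))
  (ℕ.*-mono-≤ (h u) (k u))

PolyBounded-^ : ∀ {f} → PolyBounded f → ∀ c → PolyBounded (λ n → f n ℕ.^ c)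
PolyBounded-^ h zero    = PolyBounded-const 1
PolyBounded-^ h (suc c) = PolyBounded-* h (PolyBounded-^ h c)

PolyBounded-+ : ∀ {f g} → PolyBounded f → PolyBounded g → PolyBounded (λ n → f n ℕ.+ g n)
PolyBounded-+ {f} {g} (d , h) (e , k) = suc (d ℕ.+ e) , λ u → ℕ.≤-trans
  (ℕ.+-mono-≤ (ℕ.≤-trans (h u) (ℕ.^-monoʳ-≤ 2 (ℕ.*-monoʳ-≤ (suc u) (ℕ.m≤m+n d e))))
              (ℕ.≤-trans (k u) (ℕ.^-monoʳ-≤ 2 (ℕ.*-monoʳ-≤ (suc u) (ℕ.m≤n+m e d)))))
  (ℕ.≤-trans (ℕ.≤-reflexive (cong (2 ℕ.^ (suc u ℕ.* (d ℕ.+ e)) ℕ.+_) (sym (ℕ.+-identityʳ _))))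
    (ℕ.^-monoʳ-≤ 2 {suc (suc u ℕ.* (d ℕ.+ e))} (subst (suc (suc u ℕ.* (d ℕ.+ e)) ℕ.≤_) (sym (ℕ.*-suc (suc u) (d ℕ.+ e)))
      (ℕ.+-monoˡ-≤ (suc u ℕ.* (d ℕ.+ e)) (s≤s {0} {u} z≤n)))))

PolyBounded-suc : ∀ {f} → PolyBounded f → PolyBounded (λ n → suc (f n))
PolyBounded-suc = PolyBounded-+ (PolyBounded-const 1)

PolyBounded-types : ∀ {f} C D z → PolyBounded f → PolyBounded (λ n → types C D (f n) z)
PolyBounded-types C D z h = PolyBounded-*
  (PolyBounded-^ (PolyBounded-suc (PolyBounded-^ (PolyBounded-suc (PolyBounded-+ h h)) C)) ((1 ℕ.+ (z ℕ.+ z)) ℕ.^ C))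
  (PolyBounded-const (D ℕ.^ z))

-- At `N = 2 ^ u` it suffices that `(u + 1) d < 2 ^ u`. For `u = 2 v` and `v = 2 d + 1`, the left
-- side is below `(v + 1) ^ 2`, which is at most `2 ^ u`.
exponential : ∀ {f} → PolyBounded f → Σ ℕ λ N → f N ℕ.< 2 ℕ.^ N
exponential {f} (d , h) = 2 ℕ.^ u , ℕ.≤-<-trans (h u) (ℕ.^-monoʳ-< 2 (s≤s (s≤s z≤n)) beats)
  where
  v u : ℕ
  v = suc (d ℕ.+ d)
  u = v ℕ.+ v
  lemma : ∀ d → suc (suc (d ℕ.+ d) ℕ.+ suc (d ℕ.+ d)) ℕ.* d ℕ.+ suc (5 ℕ.* d ℕ.+ 3)
              ≡ suc (suc (d ℕ.+ d)) ℕ.* suc (suc (d ℕ.+ d))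
  lemma = ℕ.solve-∀
  beats : suc u ℕ.* d ℕ.< 2 ℕ.^ u
  beats = ℕ.<-≤-trans (subst (suc u ℕ.* d ℕ.<_) (lemma d) (ℕ.m<m+n (suc u ℕ.* d) (s≤s z≤n)))
    (subst (suc v ℕ.* suc v ℕ.≤_) (sym (ℕ.^-distribˡ-+-* 2 v v)) (ℕ.*-mono-≤ (n<2^n v) (n<2^n v)))

-- Enumeration of the subsets of a finite set.

side : Fin 2 → Side
side Fin.zero    = outside
side (Fin.suc _) = inside

side-injective : ∀ i j → side i ≡ side j → i ≡ j
side-injective Fin.zero           Fin.zero           _ = refl
side-injective (Fin.suc Fin.zero) (Fin.suc Fin.zero) _ = refl

subset : ∀ N → Fin (2 ℕ.^ N) → Subset N
subset N t = Vec.tabulate (side ∘ Fin.finToFun {2} {N} t)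

funToFin-cong : ∀ {m n} {f g : Fin m → Fin n} → (∀ i → f i ≡ g i) → Fin.funToFin f ≡ Fin.funToFin g
funToFin-cong {zero}  h = refl
funToFin-cong {suc m} h = cong₂ Fin.combine (h Fin.zero) (funToFin-cong (h ∘ Fin.suc))

subset-injective : ∀ N t t′ → subset N t ≡ subset N t′ → t ≡ t′
subset-injective N t t′ eq = trans (sym (Fin.funToFin-finToFin {N} {2} t))
  (trans (funToFin-cong λ i → side-injective (bits t i) (bits t′ i)
      (trans (sym (Vec.lookup∘tabulate (side ∘ bits t) i))
        (trans (cong (λ S → lookup S i) eq) (Vec.lookup∘tabulate (side ∘ bits t′) i))))
    (Fin.funToFin-finToFin {N} {2} t′))
  where bits = Fin.finToFun {2} {N}

-- Types of tuples over a finite parameter set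

module Counting (p : ℕ) .{{p≢0 : NonZero p}} (prime : Prime p) (m k s : ℕ) where

  open Span p
  open Game p prime

  -- Coefficients matter only modulo `p`, so these `p ^ n` vectors represent all combinations.
  scalars : ∀ {n} → Fin (p ℕ.^ n) → Fin n → ℤ
  scalars j i = + toℕ (Fin.finToFun j i)

  residue : ℤ → Fin p
  residue c = fromℕ< (ℤ.n%ℕd<d c p)

  residue-≋ : ∀ {c d} → residue c ≡ residue d → c ≋[ p ] d
  residue-≋ {c} {d} eq = ≋-trans (%ℕ-≋ p c) (≋-trans (≋-reflexive (cong +_
    (Fin.fromℕ<-injective (c ℤ.%ℕ p) (d ℤ.%ℕ p) (ℤ.n%ℕd<d c p) (ℤ.n%ℕd<d d p) eq))) (≋-sym (%ℕ-≋ p d)))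

  reduced : ∀ {n} → (Fin n → ℤ) → Fin (p ℕ.^ n)
  reduced l = Fin.funToFin (residue ∘ l)

  scalars-reduced : ∀ {n} (l : Fin n → ℤ) i → l i ≋[ p ] scalars (reduced l) i
  scalars-reduced l i = ≋-trans (%ℕ-≋ p (l i)) (≋-reflexive (cong +_
    (trans (sym (Fin.toℕ-fromℕ< (ℤ.n%ℕd<d (l i) p))) (cong toℕ (sym (Fin.finToFun-funToFin (residue ∘ l) i))))))

  Sp-poly : ∀ {t} (u u′ : Vec (ℤ × ℕ) t) → (∀ i → proj₁ (lookup u i) ≋[ p ] proj₁ (lookup u′ i)) →
            (∀ i → R (proj₂ (lookup u i)) (proj₂ (lookup u′ i))) → Sp R (poly u) (poly u′)
  Sp-poly []            []              hc hr = nil (λ y → ≋-refl) (λ y → ≋-refl)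
  Sp-poly ((c , x) ∷ u) ((c′ , x′) ∷ u′) hc hr =
    cons c (hr Fin.zero) (Sp-poly u u′ (hc ∘ Fin.suc) (hr ∘ Fin.suc)) (λ y → ≋-refl)
      (λ y → +-cong (*-cong (≋-sym (hc Fin.zero)) ≋-refl) ≋-refl)

  -- The exponent 1 and `2 s` exponents for the gap between any two parameters, for each coefficient
  -- vector.
  size-A : ℕ → ℕ
  size-A N = suc (p ℕ.^ m ℕ.* (N ℕ.* (N ℕ.* (s ℕ.+ s))))

  -- Independent of `N`, so that `types` stays polynomial in `N`.
  size-Z : ℕ
  size-Z = p ℕ.^ m ℕ.* (p ℕ.^ k ℕ.* s)

  classes : ℕ → ℕ
  classes N = types (bound s) (modulus s) (size-A N) size-Z
              ℕ.* (suc (N ℕ.* p ℕ.^ s) ℕ.^ (p ℕ.^ k)) ℕ.^ (p ℕ.^ m)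

  classes-poly : PolyBounded classes
  classes-poly = PolyBounded-* (PolyBounded-types (bound s) (modulus s) size-Z size-A-poly)
    (PolyBounded-^ (PolyBounded-^ (PolyBounded-suc (PolyBounded-* PolyBounded-id (PolyBounded-const (p ℕ.^ s)))) (p ℕ.^ k)) (p ℕ.^ m))
    where
    size-A-poly : PolyBounded size-A
    size-A-poly = PolyBounded-suc (PolyBounded-* (PolyBounded-const (p ℕ.^ m))
      (PolyBounded-* PolyBounded-id (PolyBounded-* PolyBounded-id (PolyBounded-const (s ℕ.+ s)))))

  module _ {N M : ℕ} (a : Fin N → Vector (Poly p) m) (b : Fin M → Vector (Poly p) k) where

    base : Fin (p ℕ.^ m) → Fin N → F
    base j i = comb (scalars j) ⟦ a i ⟧*

    gap : Fin (p ℕ.^ m) → Fin N → Fin N → F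
    gap j i i′ y = base j i y - base j i′ y

    mixed : Fin (p ℕ.^ m) → Fin (p ℕ.^ k) → Fin N → Fin M → F
    mixed j j′ i t y = base j i y + comb (scalars j′) ⟦ b t ⟧* y

    Near : Fin (p ℕ.^ m) → Fin (p ℕ.^ k) → Fin M → Set
    Near j j′ t = Σ (Fin N) λ i → Short s (mixed j j′ i t)

    comb-mixed : ∀ l i t → comb l ⟦ a i Vector.++ b t ⟧* ≃
                 mixed (reduced (λ i → l (i Fin.↑ˡ k))) (reduced (λ i → l (m Fin.↑ʳ i))) i t
    comb-mixed l i t y = ≋-trans (≋-reflexive (comb-++ m l ⟦ a i Vector.++ b t ⟧* y)) (+-cong
      (comb-cong _ _ _ _ y (scalars-reduced (λ i → l (i Fin.↑ˡ k)))
        (λ q → ≋-reflexive (cong (λ c → ⟦ c ⟧ y) (Vector.lookup-++ˡ (a i) (b t) q))))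
      (comb-cong _ _ _ _ y (scalars-reduced (λ i → l (m Fin.↑ʳ i)))
        (λ q → ≋-reflexive (cong (λ c → ⟦ c ⟧ y) (Vector.lookup-++ʳ (a i) (b t) q)))))

    -- The decisions are arguments here; being finitely many, they are obtained later under a double
    -- negation.
    module Decided (short? : ∀ j i i′ → Dec (Short (s ℕ.+ s) (gap j i i′)))
                   (near?  : ∀ j j′ t → Dec (Near j j′ t)) where

      support : ∀ {t f} → Dec (Short t f) → Fin t → ℕ
      support (yes (u , _)) q = proj₂ (lookup u q)
      -- The default pads the list, so that its length does not depend on the decisions.
      support (no _)        q = 0

      place : ∀ {j j′ t} → Dec (Near j j′ t) → Fin s → ℕ
      place (yes (i , u , _)) q = proj₂ (lookup u q)
      place (no _)            q = 0

      -- All that is kept of a short combination besides its exponents, which are recorded by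
      -- `place`.
      shape : ∀ {j j′ t} → Dec (Near j j′ t) → Fin (suc (N ℕ.* p ℕ.^ s))
      shape (yes (i , u , _)) = Fin.suc (Fin.combine i (reduced (λ q → proj₁ (lookup u q))))
      shape (no _)            = Fin.zero

      supports : Fin (p ℕ.^ m) → Fin N → Fin N → List ℕ
      supports j i i′ = List.tabulate (support (short? j i i′))

      places : Fin (p ℕ.^ m) → Fin (p ℕ.^ k) → List (Fin M → ℕ)
      places j j′ = List.tabulate λ q t → place (near? j j′ t) q

      A : List ℕ
      A = 1 ∷ gather λ j → gather λ i → gather (supports j i)

      Z : List (Fin M → ℕ)
      Z = gather λ j → gather (places j)

      support∈A : ∀ j i i′ q → support (short? j i i′) q ∈ A
      support∈A j i i′ q = there (∈-gather (λ j → gather λ i → gather (supports j i)) j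
        (∈-gather (λ i → gather (supports j i)) i (∈-gather (supports j i) i′ (∈.∈-tabulate⁺ {f = support (short? j i i′)} q))))

      place∈Z : ∀ j j′ q → (λ t → place (near? j j′ t) q) ∈ Z
      place∈Z j j′ q = ∈-gather (λ j → gather (places j)) j
        (∈-gather (places j) j′ (∈.∈-tabulate⁺ {f = λ q t → place (near? j j′ t) q} q))

      length-A : length A ≡ size-A N
      length-A = cong suc (length-gather _ _ λ j → length-gather _ _ λ i → length-gather _ _ λ i′ →
        List.length-tabulate (support (short? j i i′)))

      length-Z : length Z ≡ size-Z
      length-Z = length-gather _ _ λ j → length-gather _ _ λ j′ → List.length-tabulate λ q t → place (near? j j′ t) q

      open Forms A Z

      Same : Fin M → Fin M → Set
      Same t t′ = PEₙ s (Match t t′) × (∀ j j′ → shape (near? j j′ t) ≡ shape (near? j j′ t′))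

      -- Equal shapes give the same near parameter `i₀` and the same coefficients. At `i` both
      -- combinations differ from those at `i₀` by one common gap. If the gap is short, its
      -- exponents are in `A` and are fixed; otherwise a short combination at `i` would make it a
      -- sum of `2 s` monomials.
      near-agree : ∀ {R j j′ i t t′} (d : Dec (Near j j′ t)) (d′ : Dec (Near j j′ t′)) → shape d ≡ shape d′ →
                   (∀ i′ q → R (support (short? j i i′) q) (support (short? j i i′) q)) →
                   (∀ q → R (place d q) (place d′ q)) →
                   Sp R (mixed j j′ i t) (mixed j j′ i t′) ⊎ (¬ Short s (mixed j j′ i t) × ¬ Short s (mixed j j′ i t′))
      near-agree {i = i} (no ¬n) (no ¬n′) _ _ _ = inj₂ ((λ sh → ¬n (i , sh)) , (λ sh → ¬n′ (i , sh)))
      near-agree {R} {j} {j′} {i} {t} {t′} (yes (i₀ , u , h)) (yes (i₀′ , u′ , h′)) eq hA hZ =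
        go (short? j i i₀) (hA i₀)
        where
        parts : i₀ ≡ i₀′ × reduced (λ q → proj₁ (lookup u q)) ≡ reduced (λ q → proj₁ (lookup u′ q))
        parts = Fin.combine-injective i₀ (reduced (λ q → proj₁ (lookup u q))) i₀′ (reduced (λ q → proj₁ (lookup u′ q))) (Fin.suc-injective eq)
        h″ : mixed j j′ i₀ t′ ≃ poly u′
        h″ = subst (λ i → mixed j j′ i t′ ≃ poly u′) (sym (proj₁ parts)) h′
        decompose : ∀ {t} (u : Vec (ℤ × ℕ) s) → mixed j j′ i₀ t ≃ poly u → mixed j j′ i t ≃ λ y → gap j i i₀ y + poly u y
        decompose {t} u h y = ≋-via 1ℤ (h y) (lemma (base j i y) (base j i₀ y) (comb (scalars j′) ⟦ b t ⟧* y) (poly u y))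
          where lemma : ∀ x x₀ c u → x + c ≡ x - x₀ + u + 1ℤ * (x₀ + c - u)
                lemma = solve-∀
        far : ∀ {t} (u : Vec (ℤ × ℕ) s) → mixed j j′ i₀ t ≃ poly u → ¬ Short (s ℕ.+ s) (gap j i i₀) →
              ¬ Short s (mixed j j′ i t)
        far {t} u h ns sh = ns (Short-resp
          (λ y → ≋-via 1ℤ (decompose u h y) (lemma (mixed j j′ i t y) (poly u y) (gap j i i₀ y)))
          (Short-+ sh (Short-* (- 1ℤ) (u , λ y → ≋-refl))))
          where lemma : ∀ x u g → x + - 1ℤ * u ≡ g + 1ℤ * (x - (g + u))
                lemma = solve-∀
        go : (d : Dec (Short (s ℕ.+ s) (gap j i i₀))) → (∀ q → R (support d q) (support d q)) →
             Sp R (mixed j j′ i t) (mixed j j′ i t′) ⊎ (¬ Short s (mixed j j′ i t) × ¬ Short s (mixed j j′ i t′))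
        go (yes (w , g)) hA = inj₁ (Sp-resp (λ y → ≋-sym (decompose u h y)) (λ y → ≋-sym (decompose u′ h″ y))
          (Sp-+ (Sp-resp (λ y → ≋-sym (g y)) (λ y → ≋-sym (g y)) (Sp-poly w w (λ _ → ≋-refl) hA))
                (Sp-poly u u′ (λ q → residue-≋ (funToFin-injective _ _ (proj₂ parts) q)) hZ)))
        go (no ns) hA = inj₂ (far u h ns , far u′ h″ ns)

      -- `Same` does not mention `i`, so a single class serves all parameters at once.
      same⇒~ : ∀ {t t′} → Same t t′ → ∀ i → ⟦ a i Vector.++ b t ⟧* ~⟨ s ⟩ ⟦ a i Vector.++ b t′ ⟧*
      same⇒~ {t} {t′} (pe , shapes) i = record { rel-on = Match t t′ ; presburger = pe ; dichotomy = dich }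
        where
        dich : ∀ l → Sp (Match t t′) (comb l ⟦ a i Vector.++ b t ⟧*) (comb l ⟦ a i Vector.++ b t′ ⟧*) ⊎
                     (¬ Short s (comb l ⟦ a i Vector.++ b t ⟧*) × ¬ Short s (comb l ⟦ a i Vector.++ b t′ ⟧*))
        dich l with near-agree {i = i} (near? (reduced (λ i → l (i Fin.↑ˡ k))) (reduced (λ i → l (m Fin.↑ʳ i))) t)
                      (near? _ _ t′) (shapes _ _)
                      (λ i′ q → inj₁ (support∈A _ i i′ q , refl))
                      (λ q → inj₂ ((λ t → place (near? _ _ t) q) , place∈Z _ _ q , refl , refl))
        ... | inj₁ sp = inj₁ (Sp-resp (λ y → ≋-sym (comb-mixed l i t y)) (λ y → ≋-sym (comb-mixed l i t′ y)) sp)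
        ... | inj₂ (ns , ns′) = inj₂ (ns ∘ Short-resp (comb-mixed l i t) , ns′ ∘ Short-resp (comb-mixed l i t′))

      codes-Same : Codes Same (classes N)
      codes-Same = codes-×
        (subst₂ (λ x z → Codes (λ t t′ → PEₙ s (Match t t′)) (types (bound s) (modulus s) x z)) length-A length-Z
          (codes-PE (bound s) (modulus s) {{modulus≢0 s}} (here refl)))
        (codes-Π λ j → codes-Π λ j′ → codes-≡ (λ t → shape (near? j j′ t)))


-- A shattered set contradicts the count of classes.

module Collision (p : ℕ) .{{p≢0 : NonZero p}} (prime : Prime p) (m k : ℕ) (φ : Formula p (m ℕ.+ k)) where

  open Span p
  open Game p prime
  open Counting p prime m k (threshold (depth φ))

  module _ {N : ℕ} (a : Fin N → Vector (Poly p) m) (b : Subset N → Vector (Poly p) k)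
           (shatters : ∀ i S → (Sat p φ (a i Vector.++ b S) → i Subset.∈ S) × (i Subset.∈ S → Sat p φ (a i Vector.++ b S))) where

    included : ∀ {S S′} → (∀ i → ⟦ a i Vector.++ b S ⟧* ~⟨ threshold (depth φ) ⟩ ⟦ a i Vector.++ b S′ ⟧*) → S Subset.⊆ S′
    included {S} {S′} alike {i} i∈ =
      proj₁ (shatters i S′) (transfer φ (depth φ) ℕ.≤-refl (alike i) (proj₂ (shatters i S) i∈))

    -- Two distinct subsets share a code; their tuples then satisfy the same instances of `φ`, so
    -- the subsets contain each other.
    collision : ∀ {_∼_ K} → K ℕ.< 2 ℕ.^ N → Codes _∼_ K →
                (∀ {t t′} → t ∼ t′ → ∀ i →
                  ⟦ a i Vector.++ b (subset N t) ⟧* ~⟨ threshold (depth φ) ⟩ ⟦ a i Vector.++ b (subset N t′) ⟧*) → ⊥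
    collision K<2^N (code , sound) alike with t , t′ , t<t′ , eq ← Fin.pigeonhole K<2^N code =
      ℕ.<⇒≢ t<t′ (cong toℕ (subset-injective N t t′
        (Subset.⊆-antisym (included (alike (sound t t′ eq))) (included (alike (sound t′ t (sym eq)))))))

    not-shattered : classes N ℕ.< 2 ℕ.^ N → ⊥
    not-shattered small =
      -- The goal is absurdity, so all these decisions may be assumed made.
      (¬¬-choice λ j → ¬¬-choice λ i → ¬¬-choice λ i′ → lem (Short _ (gap a b′ j i i′))) λ short? →
      (¬¬-choice λ j → ¬¬-choice λ j′ → ¬¬-choice λ t → lem (Near a b′ j j′ t)) λ near? →
      collision small (Decided.codes-Same a b′ short? near?) (Decided.same⇒~ a b′ short? near?)
      where b′ = b ∘ subset N

  no-IP : ¬ HasIP p m k φ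
  no-IP ip = let N , small = exponential classes-poly
                 a , b , shatters = ip N
             in not-shattered a b shatters small

theorem7p8 : (p : ℕ) .{{_ : NonZero p}} → Prime p → 7 ℕ.≤ p → NIP p
theorem7p8 p p-prime _ = Collision.no-IP p p-prime
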